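{- Let $\lambda$ be a nonzero real number and $n\ge1$ an integer. Then, as polynomials in $x$, $$\sum_{k=1}^{n}S_{2,\lambda}(n,k)\frac{x^{k}}{k}=\frac{1}{n}\sum_{j=0}^{n-1}\binom{n}{j}\beta_{j,\lambda}(1-\lambda)\,\phi_{n-j,\lambda}(x).$$ In particular, for $x=1$, $$\sum_{k=1}^{n}\frac{S_{2,\lambda}(n,k)}{k}=\frac{1}{n}\sum_{j=0}^{n-1}\binom{n}{j}\beta_{j,\lambda}(1-\lambda)\,\phi_{n-j,\lambda},$$ where $\phi_{m,\lambda}=\phi_{m,\lambda}(1)$.
   Context: For real $y$ and integer $k\ge0$: $(y)_{0,\lambda}=1$, $(y)_{k,\lambda}=y(y-\lambda)\cdots(y-(k-1)\lambda)$; $(y)_0=1$, $(y)_k=y(y-1)\cdots(y-k+1)$. The degenerate exponential is $e_\lambda^x(t)=\sum_{k\ge0}(x)_{k,\lambda}t^k/k!=(1+\lambda t)^{x/\lambda}$, $e_\lambda(t)=e^1_\lambda(t)$. The degenerate Bernoulli polynomials are defined by $\frac{t}{e_\lambda(t)-1}e_\lambda^x(t)=\sum_{n\ge0}\beta_{n,\lambda}(x)\frac{t^n}{n!}$. The degenerate Bell polynomials are defined by $e^{x(e_\lambda(t)-1)}=\sum_{n\ge0}\phi_{n,\lambda}(x)\frac{t^n}{n!}$, and the degenerate Bell numbers are $\phi_{n,\lambda}=\phi_{n,\lambda}(1)$. The degenerate Stirling numbers of the second kind are defined by $(x)_{n,\lambda}=\sum_{k=0}^{n}S_{2,\lambda}(n,k)(x)_{k}$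 ($n\ge0$). -}

module Defs where

open import Algebra.Bundles using (CommutativeRing)
open import Algebra.Bundles.Raw using (RawRing)
import Algebra.Definitions.RawSemiring as RawPower
open import Data.Integer.Base using (+_)
open import Data.List.Base using (List; []; _∷_; map)
open import Data.Nat.Base using (ℕ; zero; suc; _∸_; _⊔_; _≤_; _<_; s≤s; _!; NonZero)
import Data.Nat.Properties as ℕₚ
open import Data.Nat.Properties using (_!≢0)
open import Data.Product.Base using (∃; _×_; _,_; proj₁; proj₂)
open import Data.Rational.Base as ℚ using (ℚ; 0ℚ; 1ℚ; ½; ∣_∣; _/_)
import Data.Rational.Properties as ℚₚ
open import Level using (0ℓ) renaming (_⊔_ to _⊔ˡᵛ_)
open import Relation.Binary.PropositionalEquality.Core using (_≡_; refl; sym; trans; cong; subst)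

-- Cauchy sequences of rationals; real numbers are equal when ≈ℝ holds.

record ℝ : Set where
  constructor mkℝ
  field
    seq    : ℕ → ℚ
    cauchy : ∀ ε → 0ℚ ℚ.< ε →
             ∃ λ N → ∀ m n → N ≤ m → N ≤ n → ∣ seq m ℚ.- seq n ∣ ℚ.< ε

open ℝ public

infix 4 _≈ℝ_

_≈ℝ_ : ℝ → ℝ → Set
x ≈ℝ y = ∀ ε → 0ℚ ℚ.< ε → ∃ λ N → ∀ n → N ≤ n → ∣ seq x n ℚ.- seq y n ∣ ℚ.< ε

private
  module Identities {c ℓ} (R : CommutativeRing c ℓ) where
    open CommutativeRing R renaming (refl to ≈-refl; sym to ≈-sym; trans to ≈-trans)
    open import Algebra.Properties.Ring ring using (-‿distribʳ-*; -‿+-comm; -‿involutive)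
    open import Algebra.Properties.CommutativeSemigroup +-commutativeSemigroup using (interchange)
    open import Relation.Binary.Reasoning.Setoid setoid

    sub-add : ∀ a b → (a - b) + b ≈ a
    sub-add a b = begin
      (a - b) + b    ≈⟨ +-assoc a (- b) b ⟩
      a + (- b + b)  ≈⟨ +-congˡ (-‿inverseˡ b) ⟩
      a + 0#         ≈⟨ +-identityʳ a ⟩
      a              ∎

    sub-add-sub : ∀ a b c → (a - b) + (b - c) ≈ a - c
    sub-add-sub a b c = begin
      (a - b) + (b - c)  ≈⟨ +-assoc (a - b) b (- c) ⟨
      ((a - b) + b) - c  ≈⟨ +-congʳ (sub-add a b) ⟩
      a - c              ∎

    sub-+-sub : ∀ a b c d → (a - c) + (b - d) ≈ (a + b) - (c + d)
    sub-+-sub a b c d = begin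
      (a - c) + (b - d)      ≈⟨ interchange a (- c) b (- d) ⟩
      (a + b) + (- c + - d)  ≈⟨ +-congˡ (-‿+-comm c d) ⟩
      (a + b) - (c + d)      ∎

    neg-sub : ∀ a b → - (b - a) ≈ a - b
    neg-sub a b = begin
      - (b - a)    ≈⟨ -‿+-comm b (- a) ⟨
      - b + - - a  ≈⟨ +-comm (- b) (- - a) ⟩
      - - a - b    ≈⟨ +-congʳ (-‿involutive a) ⟩
      a - b        ∎

    *-sub : ∀ a b c → a * (b - c) ≈ a * b - a * c
    *-sub a b c = begin
      a * (b - c)        ≈⟨ distribˡ a b (- c) ⟩
      a * b + a * (- c)  ≈⟨ +-congˡ (-‿distribʳ-* a c) ⟨
      a * b - a * c      ∎

    product-sub : ∀ a b c d → a * (b - d) + d * (a - c) ≈ a * b - c * d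
    product-sub a b c d = begin
      a * (b - d) + d * (a - c)          ≈⟨ +-cong (*-sub a b d) (*-sub d a c) ⟩
      (a * b - a * d) + (d * a - d * c)  ≈⟨ +-congˡ (+-cong (*-comm d a) (-‿cong (*-comm d c))) ⟩
      (a * b - a * d) + (a * d - c * d)  ≈⟨ sub-add-sub (a * b) (a * d) (c * d) ⟩
      a * b - c * d                      ∎

  open Identities ℚₚ.+-*-commutativeRing

  0<½ε : ∀ {ε} → 0ℚ ℚ.< ε → 0ℚ ℚ.< ½ ℚ.* ε
  0<½ε {ε} 0<ε =
    ℚₚ.positive⁻¹ (½ ℚ.* ε) {{ℚₚ.pos*pos⇒pos ½ ε {{ℚ.positive 0<ε}}}}

  ½ε+½ε : ∀ ε → ½ ℚ.* ε ℚ.+ ½ ℚ.* ε ≡ ε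
  ½ε+½ε ε = trans (sym (ℚₚ.*-distribʳ-+ ε ½ ½)) (ℚₚ.*-identityˡ ε)

  ∣p-p∣<ε : ∀ {p q ε} → p ≡ q → 0ℚ ℚ.< ε → ∣ p ℚ.- q ∣ ℚ.< ε
  ∣p-p∣<ε {p} {ε = ε} refl 0<ε =
    subst (λ r → ∣ r ∣ ℚ.< ε) (sym (ℚₚ.+-inverseʳ p)) 0<ε

  ∣p-q∣≡∣q-p∣ : ∀ p q → ∣ p ℚ.- q ∣ ≡ ∣ q ℚ.- p ∣
  ∣p-q∣≡∣q-p∣ p q = trans
    (cong ∣_∣ (sym (neg-sub p q)))
    (ℚₚ.∣-p∣≡∣p∣ (q ℚ.- p))

  ∣p+q∣<ε : ∀ {p q ε} → ∣ p ∣ ℚ.< ½ ℚ.* ε → ∣ q ∣ ℚ.< ½ ℚ.* ε → ∣ p ℚ.+ q ∣ ℚ.< ε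
  ∣p+q∣<ε {p} {q} {ε} p< q< = ℚₚ.≤-<-trans (ℚₚ.∣p+q∣≤∣p∣+∣q∣ p q)
    (subst (∣ p ∣ ℚ.+ ∣ q ∣ ℚ.<_) (½ε+½ε ε) (ℚₚ.+-mono-< p< q<))

  triangle : ∀ {ε} a b c → ∣ a ℚ.- b ∣ ℚ.< ½ ℚ.* ε → ∣ b ℚ.- c ∣ ℚ.< ½ ℚ.* ε →
             ∣ a ℚ.- c ∣ ℚ.< ε
  triangle {ε} a b c p q = subst (λ r → ∣ r ∣ ℚ.< ε)
    (sub-add-sub a b c)
    (∣p+q∣<ε p q)

  sum-bound : ∀ {ε} a b c d → ∣ a ℚ.- c ∣ ℚ.< ½ ℚ.* ε → ∣ b ℚ.- d ∣ ℚ.< ½ ℚ.* ε →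
              ∣ (a ℚ.+ b) ℚ.- (c ℚ.+ d) ∣ ℚ.< ε
  sum-bound {ε} a b c d p q = subst (λ r → ∣ r ∣ ℚ.< ε)
    (sub-+-sub a b c d)
    (∣p+q∣<ε p q)

  neg-bound : ∀ {ε} a b → ∣ a ℚ.- b ∣ ℚ.< ε → ∣ ℚ.- a ℚ.- ℚ.- b ∣ ℚ.< ε
  neg-bound {ε} a b = subst (ℚ._< ε) (trans (sym (ℚₚ.∣-p∣≡∣p∣ (a ℚ.- b)))
    (cong ∣_∣ (ℚₚ.neg-distrib-+ a (ℚ.- b))))

  module _ (B : ℚ) (0<B : 0ℚ ℚ.< B) (ε : ℚ) (0<ε : 0ℚ ℚ.< ε) where
    private instance
      B-pos : ℚ.Positive B
      B-pos = ℚ.positive 0<B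
      B-nonZero : ℚ.NonZero B
      B-nonZero = ℚₚ.pos⇒nonZero B

    δ : ℚ
    δ = ℚ.1/ B ℚ.* (½ ℚ.* ε)

    0<δ : 0ℚ ℚ.< δ
    0<δ = ℚₚ.positive⁻¹ δ {{ℚₚ.pos*pos⇒pos (ℚ.1/ B) {{ℚₚ.1/pos⇒pos B}} (½ ℚ.* ε) {{ℚ.positive (0<½ε 0<ε)}}}}

    Bδ : B ℚ.* δ ≡ ½ ℚ.* ε
    Bδ = trans (sym (ℚₚ.*-assoc B (ℚ.1/ B) (½ ℚ.* ε)))
      (trans (cong (ℚ._* (½ ℚ.* ε)) (ℚₚ.*-inverseʳ B)) (ℚₚ.*-identityˡ (½ ℚ.* ε)))

    ∣p*q∣<½ε : ∀ p q → ∣ p ∣ ℚ.< B → ∣ q ∣ ℚ.< δ → ∣ p ℚ.* q ∣ ℚ.< ½ ℚ.* ε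
    ∣p*q∣<½ε p q p< q< = begin-strict
      ∣ p ℚ.* q ∣      ≡⟨ ℚₚ.∣p*q∣≡∣p∣*∣q∣ p q ⟩
      ∣ p ∣ ℚ.* ∣ q ∣  ≤⟨ ℚₚ.*-monoʳ-≤-nonNeg ∣ q ∣ {{ℚ.nonNegative (ℚₚ.0≤∣p∣ q)}} (ℚₚ.<⇒≤ p<) ⟩
      B ℚ.* ∣ q ∣      <⟨ ℚₚ.*-monoʳ-<-pos B q< ⟩
      B ℚ.* δ          ≡⟨ Bδ ⟩
      ½ ℚ.* ε          ∎
      where open ℚₚ.≤-Reasoning

    product-bound : ∀ a b c d → ∣ a ∣ ℚ.< B → ∣ d ∣ ℚ.< B →
                    ∣ a ℚ.- c ∣ ℚ.< δ → ∣ b ℚ.- d ∣ ℚ.< δ →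
                    ∣ a ℚ.* b ℚ.- c ℚ.* d ∣ ℚ.< ε
    product-bound a b c d a< d< ac bd = subst (λ r → ∣ r ∣ ℚ.< ε)
      (product-sub a b c d)
      (∣p+q∣<ε (∣p*q∣<½ε a (b ℚ.- d) a< bd) (∣p*q∣<½ε d (a ℚ.- c) d< ac))

  0<1 : 0ℚ ℚ.< 1ℚ
  0<1 = ℚₚ.positive⁻¹ 1ℚ

  bounded : ∀ x → ∃ λ B → ∃ λ N → ∀ n → N ≤ n → ∣ seq x n ∣ ℚ.< B
  bounded x with cauchy x 1ℚ 0<1
  ... | N , h = 1ℚ ℚ.+ ∣ seq x N ∣ , N , λ n N≤n → ℚₚ.≤-<-trans
    (subst (ℚ._≤ ∣ seq x n ℚ.- seq x N ∣ ℚ.+ ∣ seq x N ∣)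
      (cong ∣_∣ (sub-add (seq x n) (seq x N)))
      (ℚₚ.∣p+q∣≤∣p∣+∣q∣ (seq x n ℚ.- seq x N) (seq x N)))
    (ℚₚ.+-monoˡ-< ∣ seq x N ∣ (h n N N≤n ℕₚ.≤-refl))

  bounded₂ : ∀ x y → ∃ λ B → 0ℚ ℚ.< B × ∃ λ N → ∀ m n → N ≤ m → N ≤ n →
             ∣ seq x m ∣ ℚ.< B × ∣ seq y n ∣ ℚ.< B
  bounded₂ x y with bounded x | bounded y
  ... | B , M , p | D , N , q = B ℚ.⊔ D ,
    ℚₚ.≤-<-trans (ℚₚ.0≤∣p∣ (seq x M)) (ℚₚ.<-≤-trans (p M ℕₚ.≤-refl) (ℚₚ.p≤p⊔q B D)) ,
    M ⊔ N , λ m n m≥ n≥ →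
      ℚₚ.<-≤-trans (p m (ℕₚ.≤-trans (ℕₚ.m≤m⊔n M N) m≥)) (ℚₚ.p≤p⊔q B D) ,
      ℚₚ.<-≤-trans (q n (ℕₚ.≤-trans (ℕₚ.m≤n⊔m M N) n≥)) (ℚₚ.p≤q⊔p B D)

  ⊔ˡ : ∀ {m n o} → m ⊔ n ≤ o → m ≤ o
  ⊔ˡ {m} {n} = ℕₚ.m⊔n≤o⇒m≤o m n

  ⊔ʳ : ∀ {m n o} → m ⊔ n ≤ o → n ≤ o
  ⊔ʳ {m} {n} = ℕₚ.m⊔n≤o⇒n≤o m n

fromℚ : ℚ → ℝ
fromℚ q = mkℝ (λ _ → q) λ ε 0<ε → 0 , λ m n _ _ → ∣p-p∣<ε {q} refl 0<ε

0ℝ 1ℝ : ℝ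
0ℝ = fromℚ 0ℚ
1ℝ = fromℚ 1ℚ

infixl 6 _+ℝ_
infixl 7 _*ℝ_
infix  8 -ℝ_

_+ℝ_ : ℝ → ℝ → ℝ
seq    (x +ℝ y) n = seq x n ℚ.+ seq y n
cauchy (x +ℝ y) ε 0<ε with cauchy x (½ ℚ.* ε) (0<½ε 0<ε) | cauchy y (½ ℚ.* ε) (0<½ε 0<ε)
... | M , p | N , q = M ⊔ N , λ m n m≥ n≥ →
  sum-bound (seq x m) (seq y m) (seq x n) (seq y n)
    (p m n (⊔ˡ m≥) (⊔ˡ n≥)) (q m n (⊔ʳ {M} m≥) (⊔ʳ {M} n≥))

-ℝ_ : ℝ → ℝ
seq    (-ℝ x) n = ℚ.- seq x n
cauchy (-ℝ x) ε 0<ε with cauchy x ε 0<ε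
... | N , p = N , λ m n m≥ n≥ → neg-bound (seq x m) (seq x n) (p m n m≥ n≥)

_*ℝ_ : ℝ → ℝ → ℝ
seq    (x *ℝ y) n = seq x n ℚ.* seq y n
cauchy (x *ℝ y) ε 0<ε with bounded₂ x y
... | B , 0<B , L , b with cauchy x (δ B 0<B ε 0<ε) (0<δ B 0<B ε 0<ε) | cauchy y (δ B 0<B ε 0<ε) (0<δ B 0<B ε 0<ε)
... | M , p | N , q = L ⊔ (M ⊔ N) , λ m n m≥ n≥ →
  product-bound B 0<B ε 0<ε (seq x m) (seq y m) (seq x n) (seq y n)
    (proj₁ (b m n (⊔ˡ m≥) (⊔ˡ n≥))) (proj₂ (b m n (⊔ˡ m≥) (⊔ˡ n≥)))
    (p m n (⊔ˡ (⊔ʳ {L} m≥)) (⊔ˡ (⊔ʳ {L} n≥)))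
    (q m n (⊔ʳ {M} (⊔ʳ {L} m≥)) (⊔ʳ {M} (⊔ʳ {L} n≥)))

private
  pointwise : ∀ x y → (∀ n → seq x n ≡ seq y n) → x ≈ℝ y
  pointwise x y eq ε 0<ε = 0 , λ n _ → ∣p-p∣<ε (eq n) 0<ε

  ≈ℝ-sym : ∀ {x y} → x ≈ℝ y → y ≈ℝ x
  ≈ℝ-sym {x} {y} x≈y ε 0<ε with x≈y ε 0<ε
  ... | N , p = N , λ n n≥ → subst (ℚ._< ε) (∣p-q∣≡∣q-p∣ (seq x n) (seq y n)) (p n n≥)

  ≈ℝ-trans : ∀ {x y z} → x ≈ℝ y → y ≈ℝ z → x ≈ℝ z
  ≈ℝ-trans {x} {y} {z} x≈y y≈z ε 0<ε with x≈y (½ ℚ.* ε) (0<½ε 0<ε) | y≈z (½ ℚ.* ε) (0<½ε 0<ε)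
  ... | M , p | N , q = M ⊔ N , λ n n≥ →
    triangle (seq x n) (seq y n) (seq z n) (p n (⊔ˡ n≥)) (q n (⊔ʳ {M} n≥))

  +ℝ-cong : ∀ {x y u v} → x ≈ℝ y → u ≈ℝ v → x +ℝ u ≈ℝ y +ℝ v
  +ℝ-cong {x} {y} {u} {v} x≈y u≈v ε 0<ε with x≈y (½ ℚ.* ε) (0<½ε 0<ε) | u≈v (½ ℚ.* ε) (0<½ε 0<ε)
  ... | M , p | N , q = M ⊔ N , λ n n≥ →
    sum-bound (seq x n) (seq u n) (seq y n) (seq v n) (p n (⊔ˡ n≥)) (q n (⊔ʳ {M} n≥))

  -ℝ-cong : ∀ {x y} → x ≈ℝ y → -ℝ x ≈ℝ -ℝ y
  -ℝ-cong {x} {y} x≈y ε 0<ε with x≈y ε 0<ε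
  ... | N , p = N , λ n n≥ → neg-bound (seq x n) (seq y n) (p n n≥)

  *ℝ-cong : ∀ {x y u v} → x ≈ℝ y → u ≈ℝ v → x *ℝ u ≈ℝ y *ℝ v
  *ℝ-cong {x} {y} {u} {v} x≈y u≈v ε 0<ε with bounded₂ x v
  ... | B , 0<B , L , b with x≈y (δ B 0<B ε 0<ε) (0<δ B 0<B ε 0<ε) | u≈v (δ B 0<B ε 0<ε) (0<δ B 0<B ε 0<ε)
  ... | M , p | N , q = L ⊔ (M ⊔ N) , λ n n≥ →
    product-bound B 0<B ε 0<ε (seq x n) (seq u n) (seq y n) (seq v n)
      (proj₁ (b n n (⊔ˡ n≥) (⊔ˡ n≥))) (proj₂ (b n n (⊔ˡ n≥) (⊔ˡ n≥)))
      (p n (⊔ˡ (⊔ʳ {L} n≥))) (q n (⊔ʳ {M} (⊔ʳ {L} n≥)))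

ℝ-commutativeRing : CommutativeRing 0ℓ 0ℓ
ℝ-commutativeRing = record
  { Carrier = ℝ ; _≈_ = _≈ℝ_ ; _+_ = _+ℝ_ ; _*_ = _*ℝ_ ; -_ = -ℝ_
  ; 0# = 0ℝ ; 1# = 1ℝ
  ; isCommutativeRing = record
    { isRing = record
      { +-isAbelianGroup = record
        { isGroup = record
          { isMonoid = record
            { isSemigroup = record
              { isMagma = record
                { isEquivalence = record
                  { refl  = λ {x} → pointwise x x λ _ → refl
                  ; sym   = λ {x} {y} → ≈ℝ-sym {x} {y}
                  ; trans = λ {x} {y} {z} → ≈ℝ-trans {x} {y} {z}
                  }
                ; ∙-cong = λ {x} {y} {u} {v} → +ℝ-cong {x} {y} {u} {v}
                }
              ; assoc = λ x y z → pointwise (x +ℝ y +ℝ z) (x +ℝ (y +ℝ z))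
                  λ n → ℚₚ.+-assoc (seq x n) (seq y n) (seq z n)
              }
            ; identity =
                (λ x → pointwise (0ℝ +ℝ x) x λ n → ℚₚ.+-identityˡ (seq x n)) ,
                (λ x → pointwise (x +ℝ 0ℝ) x λ n → ℚₚ.+-identityʳ (seq x n))
            }
          ; inverse =
              (λ x → pointwise (-ℝ x +ℝ x) 0ℝ λ n → ℚₚ.+-inverseˡ (seq x n)) ,
              (λ x → pointwise (x +ℝ -ℝ x) 0ℝ λ n → ℚₚ.+-inverseʳ (seq x n))
          ; ⁻¹-cong = λ {x} {y} → -ℝ-cong {x} {y}
          }
        ; comm = λ x y → pointwise (x +ℝ y) (y +ℝ x) λ n → ℚₚ.+-comm (seq x n) (seq y n)
        }
      ; *-cong = λ {x} {y} {u} {v} → *ℝ-cong {x} {y} {u} {v}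
      ; *-assoc = λ x y z → pointwise (x *ℝ y *ℝ z) (x *ℝ (y *ℝ z))
          λ n → ℚₚ.*-assoc (seq x n) (seq y n) (seq z n)
      ; *-identity =
          (λ x → pointwise (1ℝ *ℝ x) x λ n → ℚₚ.*-identityˡ (seq x n)) ,
          (λ x → pointwise (x *ℝ 1ℝ) x λ n → ℚₚ.*-identityʳ (seq x n))
      ; distrib =
          (λ x y z → pointwise (x *ℝ (y +ℝ z)) (x *ℝ y +ℝ x *ℝ z)
            λ n → ℚₚ.*-distribˡ-+ (seq x n) (seq y n) (seq z n)) ,
          (λ x y z → pointwise ((y +ℝ z) *ℝ x) (y *ℝ x +ℝ z *ℝ x)
            λ n → ℚₚ.*-distribʳ-+ (seq x n) (seq y n) (seq z n))
      }
    ; *-comm = λ x y → pointwise (x *ℝ y) (y *ℝ x) λ n → ℚₚ.*-comm (seq x n) (seq y n)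
    }
  }

ℝ-rawRing : RawRing 0ℓ 0ℓ
ℝ-rawRing = CommutativeRing.rawRing ℝ-commutativeRing

module Sum {c ℓ} (A : RawRing c ℓ) where
  open RawRing A

  -- ∑ n f = f 0 + ⋯ + f (n - 1)
  ∑ : ℕ → (ℕ → Carrier) → Carrier
  ∑ zero    f = 0#
  ∑ (suc n) f = ∑ n f + f n

module PowerSeries {c ℓ} (A : RawRing c ℓ) where
  open RawRing A
  open Sum A

  Series : Set c
  Series = ℕ → Carrier

  infixr 7 _·_
  infixl 7 _⊘_

  _·_ : Carrier → Series → Series
  (a · f) n = a * f n

  one : Series
  one zero    = 1#
  one (suc _) = 0#

  rawRing : RawRing c ℓ
  rawRing = record
    { Carrier = Series
    ; _≈_ = λ f g → ∀ n → f n ≈ g n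
    ; _+_ = λ f g n → f n + g n
    ; _*_ = λ f g n → ∑ (suc n) λ i → f i * g (n ∸ i)
    ; -_  = λ f n → - f n
    ; 0#  = λ _ → 0#
    ; 1#  = one
    }

  -- (f - f 0) / t
  tail : Series → Series
  tail f n = f (suc n)

  -- Long division, the quotient f / g for a series g with g 0 = 1:
  -- if f = g q then tail f = q 0 · tail g + g (tail q) and q 0 = f 0.
  _⊘_ : Series → Series → Series
  (f ⊘ g) zero    = f zero
  (f ⊘ g) (suc n) = ((λ i → f (suc i) + - (f zero * g (suc i))) ⊘ g) n

module Polynomial {c ℓ} (A : RawRing c ℓ) where
  open RawRing A

  -- Coefficient lists in order of increasing degree, trailing zeros allowed.
  Poly : Set c
  Poly = List Carrier

  coeff : Poly → ℕ → Carrier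
  coeff []      _       = 0#
  coeff (a ∷ p) zero    = a
  coeff (a ∷ p) (suc n) = coeff p n

  add : Poly → Poly → Poly
  add []      q       = q
  add (a ∷ p) []      = a ∷ p
  add (a ∷ p) (b ∷ q) = a + b ∷ add p q

  mul : Poly → Poly → Poly
  mul []      q = []
  mul (a ∷ p) q = add (map (a *_) q) (0# ∷ mul p q)

  const : Carrier → Poly
  const a = a ∷ []

  X : Poly
  X = 0# ∷ 1# ∷ []

  eval : Poly → Carrier → Carrier
  eval []      x = 0#
  eval (a ∷ p) x = a + x * eval p x

  rawRing : RawRing c ℓ
  rawRing = record
    { Carrier = Poly
    ; _≈_ = λ p q → ∀ n → coeff p n ≈ coeff q n
    ; _+_ = add
    ; _*_ = mul
    ; -_  = map (-_)
    ; 0#  = []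
    ; 1#  = const 1#
    }

-- A is a ring containing ℚ by way of ι.  Taking A = ℝ gives the values of the
-- following at real λ and x, and A = ℝ[X], x = X gives polynomials.
module Degenerate {c ℓ} (A : RawRing c ℓ) (ι : ℚ → RawRing.Carrier A) where
  open RawRing A
  open Sum A public
  private
    module T = PowerSeries A
    module A⟦t⟧ = RawRing T.rawRing
    open RawPower A⟦t⟧.rawSemiring using () renaming (_^_ to _^ᵗ_)

  fromℕ : ℕ → Carrier
  fromℕ n = ι (+ n / 1)

  infix 8 1/_ 1/!_

  1/_ : (n : ℕ) → .{{NonZero n}} → Carrier
  1/ n = ι (+ 1 / n)

  1/!_ : ℕ → Carrier
  1/! n = (1/ (n !)) {{n !≢0}}

  -- (y)_k
  falling : Carrier → ℕ → Carrier
  falling y zero    = 1#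
  falling y (suc k) = falling y k * (y + - fromℕ k)

  -- e^{g(t)} = ∑ gᵏ / k!  for g with g 0 = 0, so that gᵏ does not
  -- contribute to the coefficient of tⁿ when k > n.
  exp : T.Series → T.Series
  exp g n = ∑ (suc n) λ k → 1/! k * (g ^ᵗ k) n

  module _ (lam : Carrier) where

    -- (y)_{k,λ}
    degFalling : Carrier → ℕ → Carrier
    degFalling y zero    = 1#
    degFalling y (suc k) = degFalling y k * (y + - (fromℕ k * lam))

    -- e_λ^x(t)
    degExp : Carrier → T.Series
    degExp x k = degFalling x k * 1/! k

    -- e_λ(t) - 1
    degExp-1 : T.Series
    degExp-1 = degExp 1# A⟦t⟧.+ A⟦t⟧.- A⟦t⟧.1#

    -- t / (e_λ(t) - 1) = 1 / ((e_λ(t) - 1) / t), where (e_λ(t) - 1) / t has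
    -- constant coefficient (1)_{1,λ} / 1! = 1.
    t/[degExp-1] : T.Series
    t/[degExp-1] = A⟦t⟧.1# T.⊘ T.tail degExp-1

    bernoulli : Carrier → ℕ → Carrier
    bernoulli x n = fromℕ (n !) * (t/[degExp-1] A⟦t⟧.* degExp x) n

    bell : Carrier → ℕ → Carrier
    bell x n = fromℕ (n !) * exp (x T.· degExp-1) n

    -- S n k = S_{2,λ}(n,k)
    IsDegStirling₂ : (ℕ → ℕ → Carrier) → Set (c ⊔ˡᵛ ℓ)
    IsDegStirling₂ S = ∀ n x →
      degFalling x n ≈ ∑ (suc n) λ k → S n k * falling x k

-- ⊘ is a quotient, and IsDegStirling₂ is satisfiable.  The numbers S n k with
-- k ≤ n are determined by IsDegStirling₂; those with k > n are not.
module Existence {c ℓ} (R : CommutativeRing c ℓ) where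
  open CommutativeRing R hiding (zero) renaming (refl to ≈-refl; sym to ≈-sym; trans to ≈-trans; rawRing to A)
  open import Relation.Binary.Reasoning.Setoid setoid
  open import Algebra.Properties.CommutativeSemigroup +-commutativeSemigroup using (interchange)
  private module I = Identities R
  open Sum A
  open PowerSeries A hiding (rawRing)
  private module A⟦t⟧ = RawRing (PowerSeries.rawRing A)

  ∑-cong : ∀ n {f g} → (∀ i → i < n → f i ≈ g i) → ∑ n f ≈ ∑ n g
  ∑-cong zero    f≈g = ≈-refl
  ∑-cong (suc n) f≈g = +-cong (∑-cong n λ i i<n → f≈g i (ℕₚ.m<n⇒m<1+n i<n)) (f≈g n ℕₚ.≤-refl)

  ∑-+ : ∀ n f g → ∑ n (λ i → f i + g i) ≈ ∑ n f + ∑ n g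
  ∑-+ zero    f g = ≈-sym (+-identityˡ 0#)
  ∑-+ (suc n) f g = ≈-trans (+-congʳ (∑-+ n f g)) (interchange (∑ n f) (∑ n g) (f n) (g n))

  ∑-*ʳ : ∀ n f a → ∑ n f * a ≈ ∑ n (λ i → f i * a)
  ∑-*ʳ zero    f a = zeroˡ a
  ∑-*ʳ (suc n) f a = ≈-trans (distribʳ a (∑ n f) (f n)) (+-congʳ (∑-*ʳ n f a))

  ∑-head : ∀ n f → ∑ (suc n) f ≈ f 0 + ∑ n (λ i → f (suc i))
  ∑-head zero    f = +-comm 0# (f 0)
  ∑-head (suc n) f = ≈-trans (+-congʳ (∑-head n f)) (+-assoc (f 0) _ _)

  ⊘-correct : ∀ f g → g 0 ≈ 1# → g A⟦t⟧.* (f ⊘ g) A⟦t⟧.≈ f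
  ⊘-correct f g g₀≈1 zero = begin
    0# + g 0 * f 0  ≈⟨ +-identityˡ _ ⟩
    g 0 * f 0       ≈⟨ *-congʳ g₀≈1 ⟩
    1# * f 0        ≈⟨ *-identityˡ _ ⟩
    f 0             ∎
  ⊘-correct f g g₀≈1 (suc n) = begin
    ∑ (suc n) (λ i → g i * (f ⊘ g) (suc n ∸ i)) + g (suc n) * (f ⊘ g) (n ∸ n)
      ≈⟨ +-cong
           (∑-cong (suc n) λ i i≤n → reflexive (cong (λ m → g i * (f ⊘ g) m) (ℕₚ.+-∸-assoc 1 (ℕₚ.≤-pred i≤n))))
           (reflexive (cong (λ m → g (suc n) * (f ⊘ g) m) (ℕₚ.n∸n≡0 n))) ⟩
    ∑ (suc n) (λ i → g i * (f′ ⊘ g) (n ∸ i)) + g (suc n) * f 0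
      ≈⟨ +-cong (⊘-correct f′ g g₀≈1 n) (*-comm (g (suc n)) (f 0)) ⟩
    (f (suc n) - f 0 * g (suc n)) + f 0 * g (suc n)
      ≈⟨ I.sub-add (f (suc n)) (f 0 * g (suc n)) ⟩
    f (suc n) ∎
    where
    f′ : Series
    f′ i = f (suc i) + - (f 0 * g (suc i))

  module _ (ι : ℚ → Carrier) (lam : Carrier) where
    open Degenerate A ι using (fromℕ; falling; degFalling; IsDegStirling₂)

    private
      w : ℕ → ℕ → Carrier
      w n k = fromℕ k - fromℕ n * lam

      S : ℕ → ℕ → Carrier
      S zero    zero    = 1#
      S zero    (suc k) = 0#
      S (suc n) zero    = S n zero * w n zero
      S (suc n) (suc k) = S n (suc k) * w n (suc k) + S n k

      S≈0 : ∀ n k → n < k → S n k ≈ 0#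
      S≈0 zero    (suc k) _         = ≈-refl
      S≈0 (suc n) (suc k) (s≤s n<k′) = begin
        S n (suc k) * w n (suc k) + S n k  ≈⟨ +-cong (*-congʳ (S≈0 n (suc k) (ℕₚ.m<n⇒m<1+n n<k′))) (S≈0 n k n<k′) ⟩
        0# * w n (suc k) + 0#              ≈⟨ +-identityʳ _ ⟩
        0# * w n (suc k)                   ≈⟨ zeroˡ _ ⟩
        0#                                 ∎

      S-correct : IsDegStirling₂ lam S
      S-correct zero    x = ≈-sym (≈-trans (+-identityˡ _) (*-identityˡ 1#))
      S-correct (suc n) x = begin
        degFalling lam x n * (x - fromℕ n * lam)
          ≈⟨ *-congʳ (S-correct n x) ⟩
        ∑ (suc n) (λ k → S n k * falling x k) * (x - fromℕ n * lam)
          ≈⟨ ∑-*ʳ (suc n) _ _ ⟩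
        ∑ (suc n) (λ k → S n k * falling x k * (x - fromℕ n * lam))
          ≈⟨ ∑-cong (suc n) (λ k _ → step k) ⟩
        ∑ (suc n) (λ k → p k + q k)
          ≈⟨ ∑-+ (suc n) p q ⟩
        ∑ (suc n) p + ∑ (suc n) q
          ≈⟨ +-congʳ (≈-trans (+-congˡ p≈0) (+-identityʳ _)) ⟨
        ∑ (suc (suc n)) p + ∑ (suc n) q
          ≈⟨ +-congʳ (∑-head (suc n) p) ⟩
        (p 0 + ∑ (suc n) (λ k → p (suc k))) + ∑ (suc n) q
          ≈⟨ +-assoc _ _ _ ⟩
        p 0 + (∑ (suc n) (λ k → p (suc k)) + ∑ (suc n) q)
          ≈⟨ +-congˡ (∑-+ (suc n) (λ k → p (suc k)) q) ⟨
        p 0 + ∑ (suc n) (λ k → p (suc k) + q k)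
          ≈⟨ +-congˡ (∑-cong (suc n) λ k _ → ≈-sym (distribʳ _ _ _)) ⟩
        p 0 + ∑ (suc n) (λ k → S (suc n) (suc k) * falling x (suc k))
          ≈⟨ ∑-head (suc n) (λ k → S (suc n) k * falling x k) ⟨
        ∑ (suc (suc n)) (λ k → S (suc n) k * falling x k) ∎
        where
        p q : ℕ → Carrier
        p k = S n k * w n k * falling x k
        q k = S n k * falling x (suc k)

        p≈0 : p (suc n) ≈ 0#
        p≈0 = begin
          S n (suc n) * w n (suc n) * falling x (suc n)  ≈⟨ *-congʳ (*-congʳ (S≈0 n (suc n) ℕₚ.≤-refl)) ⟩
          0# * w n (suc n) * falling x (suc n)           ≈⟨ *-congʳ (zeroˡ _) ⟩
          0# * falling x (suc n)                         ≈⟨ zeroˡ _ ⟩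
          0#                                             ∎

        step : ∀ k → S n k * falling x k * (x - fromℕ n * lam) ≈ p k + q k
        step k = begin
          S n k * falling x k * (x - fromℕ n * lam)
            ≈⟨ *-congˡ (I.sub-add-sub x (fromℕ k) (fromℕ n * lam)) ⟨
          S n k * falling x k * ((x - fromℕ k) + w n k)
            ≈⟨ distribˡ _ _ _ ⟩
          S n k * falling x k * (x - fromℕ k) + S n k * falling x k * w n k
            ≈⟨ +-comm _ _ ⟩
          S n k * falling x k * w n k + S n k * falling x k * (x - fromℕ k)
            ≈⟨ +-cong
                 (≈-trans (*-assoc _ _ _) (≈-trans (*-congˡ (*-comm _ _)) (≈-sym (*-assoc _ _ _))))
                 (*-assoc _ _ _) ⟩
          p k + q k ∎

    degStirling₂-exists : ∃ (IsDegStirling₂ lam)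
    degStirling₂-exists = S , S-correct

open Degenerate ℝ-rawRing fromℚ public
  using (∑; fromℕ; 1/_; IsDegStirling₂)

ℝ[X]-rawRing : RawRing 0ℓ 0ℓ
ℝ[X]-rawRing = Polynomial.rawRing ℝ-rawRing

open Polynomial ℝ-rawRing public
  using (const; X; eval)
open RawRing ℝ[X]-rawRing public
  using () renaming (Carrier to ℝ[X]; _≈_ to _≈ˣ_; _*_ to _*ˣ_)
open RawPower (RawRing.rawSemiring ℝ[X]-rawRing) public
  using () renaming (_^_ to _^ˣ_)
open Degenerate ℝ[X]-rawRing (λ q → const (fromℚ q)) public
  using () renaming (∑ to ∑ˣ; bernoulli to bernoulliˣ; bell to bellˣ)

-- β_{n,λ}(X)
degBernoulli : ℝ → ℕ → ℝ[X]
degBernoulli lam = bernoulliˣ (const lam) X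

-- φ_{n,λ}(X)
degBell : ℝ → ℕ → ℝ[X]
degBell lam = bellˣ (const lam) X

degBellNumber : ℝ → ℕ → ℝ
degBellNumber lam n = eval (degBell lam n) 1ℝ

{-# OPTIONS --safe #-}
module Submission where

-- Write u = e_λ(t) - 1, θ = t d/dt and w = ∑ β_{n,λ}(1-λ) tⁿ/n! = (t/u) e_λ^{1-λ}(t).
-- Since u′ = e_λ^{1-λ}, we have θu = w u, hence θ(uᵏ) = k w uᵏ.  The derivation
-- L = (1 + λt) d/dt satisfies L u = 1 + u, and comparing coefficients in
-- L(uᵏ) = k (uᵏ + uᵏ⁻¹) gives the recurrence of S_{2,λ}, so ∑ₙ S_{2,λ}(n,k) tⁿ/n! = uᵏ/k!.
-- Therefore θ applied to ∑_{k≥1} (xᵏ/k) uᵏ/k! equals w (e^{xu} - 1); the claim is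
-- the coefficient of tⁿ.  This works over any commutative ring containing ℚ, in
-- particular over ℝ[X] with x = X.

-- The series w is the logarithmic derivative θu / u, which is where the values β_{j,λ}(1-λ) come
-- from. On the coefficient of tⁿ the operator θ multiplies by n, and on uᵏ it multiplies by k w, so
-- a single application trades the factors 1/k for one factor 1/n, with no integration and no
-- logarithm of a series. The sum over j stops at n - 1 because e^{xu} - 1 has no constant term. The
-- generic identity speaks of Stirling numbers produced by a recurrence and of Bernoulli values
-- computed in the ring that contains x. The theorem speaks of an arbitrary real solution of
-- `IsDegStirling₂`, and of real polynomials β_{j,λ}(X) evaluated at 1-λ and then put back into ℝ[X]
-- as constants. Two facts bridge this gap: S_{2,λ}(n,k) is unique for k ≤ n, and every construction
-- is compatible with ring homomorphisms, here the embedding of constants and the evaluations.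

open import Algebra.Bundles using (CommutativeRing)
open import Algebra.Bundles.Raw using (RawRing)
import Algebra.Definitions.RawSemiring as RawSemiringDefinitions
open import Algebra.Morphism.Construct.Composition using (isRingHomomorphism)
open import Algebra.Morphism.Structures using (IsRingHomomorphism; IsRingMonomorphism)
import Algebra.Morphism.RingMonomorphism as RingMonomorphism
open import Data.Integer.Base as ℤ using (+_)
import Data.Integer.Properties as ℤₚ
open import Data.List.Base using ([]; _∷_; map)
open import Data.Nat.Base as ℕ using (ℕ; zero; suc; _∸_; _≤_; _<_; z≤n; s≤s; z<s; _!; NonZero)
open import Data.Nat.Combinatorics using (_C_; nCk≡n!/k![n-k]!; k![n∸k]!∣n!)
open import Data.Nat.DivMod using (m/n*n≡m)
import Data.Nat.Properties as ℕₚ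
open import Data.Nat.Properties using (_!≢0; _!*_!≢0)
open import Data.Product.Base using (_×_; _,_; proj₁; proj₂)
open import Data.Rational.Base as ℚ using (ℚ; 1ℚ; _/_; fromℚᵘ)
import Data.Rational.Properties as ℚₚ
open import Data.Rational.Unnormalised.Base as ℚᵘ using (mkℚᵘ; *≡*)
import Data.Rational.Unnormalised.Properties as ℚᵘₚ
open import Data.Sum.Base using (inj₁; inj₂)
open import Defs using (module Sum; module PowerSeries; module Polynomial; module Degenerate; module Existence)
open import Relation.Binary.PropositionalEquality.Core as ≡ using (_≡_)
open import Relation.Nullary.Negation.Core using (¬_)

-- Arithmetic of fractions and binomial coefficients.

-- `fromℚᵘ` is inverse to `toℚᵘ` up to equivalence, so the law can be checked after applying the
-- injective homomorphism `toℚᵘ`.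
fromℚᵘ-homo-+ : ∀ p q → fromℚᵘ (p ℚᵘ.+ q) ≡ fromℚᵘ p ℚ.+ fromℚᵘ q
fromℚᵘ-homo-+ p q = ℚₚ.toℚᵘ-injective (begin
  ℚ.toℚᵘ (fromℚᵘ (p ℚᵘ.+ q))                   ≈⟨ ℚₚ.toℚᵘ-fromℚᵘ (p ℚᵘ.+ q) ⟩
  p ℚᵘ.+ q                                     ≈⟨ ℚᵘₚ.+-cong (ℚₚ.toℚᵘ-fromℚᵘ p) (ℚₚ.toℚᵘ-fromℚᵘ q) ⟨
  ℚ.toℚᵘ (fromℚᵘ p) ℚᵘ.+ ℚ.toℚᵘ (fromℚᵘ q)     ≈⟨ ℚₚ.toℚᵘ-homo-+ (fromℚᵘ p) (fromℚᵘ q) ⟨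
  ℚ.toℚᵘ (fromℚᵘ p ℚ.+ fromℚᵘ q)               ∎)
  where open import Relation.Binary.Reasoning.Setoid ℚᵘₚ.≃-setoid

fromℚᵘ-homo-* : ∀ p q → fromℚᵘ (p ℚᵘ.* q) ≡ fromℚᵘ p ℚ.* fromℚᵘ q
fromℚᵘ-homo-* p q = ℚₚ.toℚᵘ-injective (begin
  ℚ.toℚᵘ (fromℚᵘ (p ℚᵘ.* q))                   ≈⟨ ℚₚ.toℚᵘ-fromℚᵘ (p ℚᵘ.* q) ⟩
  p ℚᵘ.* q                                     ≈⟨ ℚᵘₚ.*-cong (ℚₚ.toℚᵘ-fromℚᵘ p) (ℚₚ.toℚᵘ-fromℚᵘ q) ⟨
  ℚ.toℚᵘ (fromℚᵘ p) ℚᵘ.* ℚ.toℚᵘ (fromℚᵘ q)     ≈⟨ ℚₚ.toℚᵘ-homo-* (fromℚᵘ p) (fromℚᵘ q) ⟨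
  ℚ.toℚᵘ (fromℚᵘ p ℚ.* fromℚᵘ q)               ∎)
  where open import Relation.Binary.Reasoning.Setoid ℚᵘₚ.≃-setoid

-- `_/_` normalises its result. The equation is therefore checked on unnormalised representatives,
-- where it is a cross-multiplied identity of integers.
[m+n]/1 : ∀ m n → + (m ℕ.+ n) / 1 ≡ (+ m / 1) ℚ.+ (+ n / 1)
[m+n]/1 m n = ≡.trans
  (ℚₚ.fromℚᵘ-cong {mkℚᵘ (+ (m ℕ.+ n)) 0} {mkℚᵘ (+ m) 0 ℚᵘ.+ mkℚᵘ (+ n) 0}
    (*≡* (≡.cong (ℤ._* + 1)
      (≡.sym (≡.cong₂ ℤ._+_ (ℤₚ.*-identityʳ (+ m)) (ℤₚ.*-identityʳ (+ n)))))))
  (fromℚᵘ-homo-+ (mkℚᵘ (+ m) 0) (mkℚᵘ (+ n) 0))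

[m*n]/1 : ∀ m n → + (m ℕ.* n) / 1 ≡ (+ m / 1) ℚ.* (+ n / 1)
[m*n]/1 m n = ≡.trans
  (ℚₚ.fromℚᵘ-cong {mkℚᵘ (+ (m ℕ.* n)) 0} {mkℚᵘ (+ m) 0 ℚᵘ.* mkℚᵘ (+ n) 0}
    (*≡* (≡.cong (ℤ._* + 1) (ℤₚ.pos-* m n))))
  (fromℚᵘ-homo-* (mkℚᵘ (+ m) 0) (mkℚᵘ (+ n) 0))

1/n*n/1 : ∀ n .{{_ : NonZero n}} → (+ 1 / n) ℚ.* (+ n / 1) ≡ 1ℚ
1/n*n/1 (suc n) = ≡.trans
  (≡.sym (fromℚᵘ-homo-* (mkℚᵘ (+ 1) n) (mkℚᵘ (+ suc n) 0)))
  (ℚₚ.fromℚᵘ-cong {mkℚᵘ (+ 1) n ℚᵘ.* mkℚᵘ (+ suc n) 0} {mkℚᵘ (+ 1) 0}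
    (*≡* (≡.trans (ℤₚ.*-identityʳ (+ 1 ℤ.* + suc n)) (≡.cong (λ d → + 1 ℤ.* + d) (≡.sym (ℕₚ.*-identityʳ (suc n)))))))

nCk*k!*[n-k]! : ∀ {n k} → k ≤ n → (n C k) ℕ.* (k ! ℕ.* (n ∸ k) !) ≡ n !
nCk*k!*[n-k]! {n} {k} k≤n = ≡.trans
  (≡.cong (ℕ._* (k ! ℕ.* (n ∸ k) !)) (nCk≡n!/k![n-k]! k≤n))
  (m/n*n≡m (k![n∸k]!∣n! k≤n))
  where instance _ = k !* (n ∸ k) !≢0

-- Finite sums in a commutative ring.

module Sums {c ℓ} (R : CommutativeRing c ℓ) where
  open CommutativeRing R hiding (zero) renaming (rawRing to A)
  open Sum A public
  open Existence R public using (∑-cong; ∑-+; ∑-*ʳ; ∑-head)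
  open import Relation.Binary.Reasoning.Setoid setoid

  ∑-zero : ∀ n {f} → (∀ i → i < n → f i ≈ 0#) → ∑ n f ≈ 0#
  ∑-zero zero    f≈0 = refl
  ∑-zero (suc n) f≈0 = trans
    (+-cong (∑-zero n λ i i<n → f≈0 i (ℕₚ.m<n⇒m<1+n i<n)) (f≈0 n ℕₚ.≤-refl))
    (+-identityʳ 0#)

  ∑-*ˡ : ∀ n a f → a * ∑ n f ≈ ∑ n (λ i → a * f i)
  ∑-*ˡ zero    a f = zeroʳ a
  ∑-*ˡ (suc n) a f = trans (distribˡ a (∑ n f) (f n)) (+-congʳ (∑-*ˡ n a f))

  ∑-swap : ∀ m n (f : ℕ → ℕ → Carrier) →
           ∑ m (λ i → ∑ n (λ j → f i j)) ≈ ∑ n (λ j → ∑ m (λ i → f i j))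
  ∑-swap zero    n f = sym (∑-zero n λ _ _ → refl)
  ∑-swap (suc m) n f = trans (+-congʳ (∑-swap m n f)) (sym (∑-+ n _ _))

  -- Brings sums with vanishing tails to a common length. In `exp-·u` this makes the range
  -- independent of the coefficient, as `∑-swap` requires.
  ∑-extend : ∀ {m n} f → m ≤ n → (∀ i → m ≤ i → f i ≈ 0#) → ∑ m f ≈ ∑ n f
  ∑-extend {n = zero}  f z≤n f≈0 = refl
  ∑-extend {m} {suc n} f m≤1+n f≈0 with ℕₚ.m≤n⇒m<n∨m≡n m≤1+n
  ... | inj₂ ≡.refl    = refl
  ... | inj₁ (s≤s m≤n) = begin
    ∑ m f        ≈⟨ ∑-extend f m≤n f≈0 ⟩
    ∑ n f        ≈⟨ +-identityʳ _ ⟨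
    ∑ n f + 0#   ≈⟨ +-congˡ (f≈0 n m≤n) ⟨
    ∑ n f + f n  ∎

-- The ring of formal power series.

module FormalSeries {c ℓ} (R : CommutativeRing c ℓ) where
  open CommutativeRing R hiding (zero) renaming (rawRing to A)
  open Sums R
  open PowerSeries A public hiding (rawRing)
  open RawRing (PowerSeries.rawRing A) public using () renaming (_*_ to _⋆_; _≈_ to _≗_)
  open import Relation.Binary.Reasoning.Setoid setoid

  -- This is f = f 0 + t · tail f multiplied by g. With its mirror image `⋆-sucʳ` it turns the ring
  -- laws into inductions on the coefficient index.
  ⋆-sucˡ : ∀ f g n → (f ⋆ g) (suc n) ≈ f 0 * g (suc n) + (tail f ⋆ g) n
  ⋆-sucˡ f g n = ∑-head (suc n) (λ i → f i * g (suc n ∸ i))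

  ⋆-sucʳ : ∀ f g n → (f ⋆ g) (suc n) ≈ (f ⋆ tail g) n + f (suc n) * g 0
  ⋆-sucʳ f g n = +-cong
    (∑-cong (suc n) λ i i≤n → reflexive (≡.cong (λ m → f i * g m) (ℕₚ.+-∸-assoc 1 (ℕₚ.≤-pred i≤n))))
    (reflexive (≡.cong (λ m → f (suc n) * g m) (ℕₚ.n∸n≡0 n)))

  ⋆-cong : ∀ {f f′ g g′} → f ≗ f′ → g ≗ g′ → f ⋆ g ≗ f′ ⋆ g′
  ⋆-cong f≈f′ g≈g′ n = ∑-cong (suc n) λ i _ → *-cong (f≈f′ i) (g≈g′ (n ∸ i))

  ⋆-·ˡ : ∀ a f g → (a · f) ⋆ g ≗ a · (f ⋆ g)
  ⋆-·ˡ a f g n = trans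
    (∑-cong (suc n) λ i _ → *-assoc a (f i) (g (n ∸ i)))
    (sym (∑-*ˡ (suc n) a _))

  ⋆-comm : ∀ f g → f ⋆ g ≗ g ⋆ f
  ⋆-comm f g zero    = +-congˡ (*-comm (f 0) (g 0))
  ⋆-comm f g (suc n) = begin
    (f ⋆ g) (suc n)                   ≈⟨ ⋆-sucˡ f g n ⟩
    f 0 * g (suc n) + (tail f ⋆ g) n  ≈⟨ +-comm _ _ ⟩
    (tail f ⋆ g) n + f 0 * g (suc n)  ≈⟨ +-cong (⋆-comm (tail f) g n) (*-comm _ _) ⟩
    (g ⋆ tail f) n + g (suc n) * f 0  ≈⟨ ⋆-sucʳ g f n ⟨
    (g ⋆ f) (suc n)                   ∎

  ⋆-distribʳ : ∀ h f g → (λ n → f n + g n) ⋆ h ≗ λ n → (f ⋆ h) n + (g ⋆ h) n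
  ⋆-distribʳ h f g n = trans
    (∑-cong (suc n) λ i _ → distribʳ (h (n ∸ i)) (f i) (g i))
    (∑-+ (suc n) _ _)

  ⋆-distribˡ : ∀ h f g → h ⋆ (λ n → f n + g n) ≗ λ n → (h ⋆ f) n + (h ⋆ g) n
  ⋆-distribˡ h f g n = trans
    (∑-cong (suc n) λ i _ → distribˡ (h i) (f (n ∸ i)) (g (n ∸ i)))
    (∑-+ (suc n) _ _)

  ⋆-identityˡ : ∀ f → one ⋆ f ≗ f
  ⋆-identityˡ f zero    = trans (+-identityˡ _) (*-identityˡ (f 0))
  ⋆-identityˡ f (suc n) = begin
    (one ⋆ f) (suc n)                    ≈⟨ ⋆-sucˡ one f n ⟩
    1# * f (suc n) + (tail one ⋆ f) n    ≈⟨ +-cong (*-identityˡ _) (∑-zero (suc n) λ i _ → zeroˡ _) ⟩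
    f (suc n) + 0#                       ≈⟨ +-identityʳ _ ⟩
    f (suc n)                            ∎

  -- The induction passes from f to `tail f`. As tail (f g) = f 0 · tail g + tail f · g, only the
  -- second summand needs the induction hypothesis, and no double sum is reindexed.
  ⋆-assoc : ∀ f g h → (f ⋆ g) ⋆ h ≗ f ⋆ (g ⋆ h)
  ⋆-assoc f g h zero = begin
    0# + (0# + f 0 * g 0) * h 0  ≈⟨ +-congˡ (*-congʳ (+-identityˡ _)) ⟩
    0# + f 0 * g 0 * h 0         ≈⟨ +-congˡ (*-assoc _ _ _) ⟩
    0# + f 0 * (g 0 * h 0)       ≈⟨ +-congˡ (*-congˡ (+-identityˡ _)) ⟨
    0# + f 0 * (0# + g 0 * h 0)  ∎
  ⋆-assoc f g h (suc n) = begin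
    ((f ⋆ g) ⋆ h) (suc n)
      ≈⟨ ⋆-sucˡ (f ⋆ g) h n ⟩
    (0# + f 0 * g 0) * h (suc n) + (tail (f ⋆ g) ⋆ h) n
      ≈⟨ +-cong (*-congʳ (+-identityˡ _)) (⋆-cong {g = h} (⋆-sucˡ f g) (λ _ → refl) n) ⟩
    f 0 * g 0 * h (suc n) + ((λ m → f 0 * tail g m + (tail f ⋆ g) m) ⋆ h) n
      ≈⟨ +-cong (*-assoc _ _ _) (⋆-distribʳ h (f 0 · tail g) (tail f ⋆ g) n) ⟩
    f 0 * (g 0 * h (suc n)) + (((f 0 · tail g) ⋆ h) n + ((tail f ⋆ g) ⋆ h) n)
      ≈⟨ +-assoc _ _ _ ⟨
    (f 0 * (g 0 * h (suc n)) + ((f 0 · tail g) ⋆ h) n) + ((tail f ⋆ g) ⋆ h) n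
      ≈⟨ +-cong (+-congˡ (⋆-·ˡ (f 0) (tail g) h n)) (⋆-assoc (tail f) g h n) ⟩
    (f 0 * (g 0 * h (suc n)) + f 0 * (tail g ⋆ h) n) + (tail f ⋆ (g ⋆ h)) n
      ≈⟨ +-congʳ (distribˡ _ _ _) ⟨
    f 0 * (g 0 * h (suc n) + (tail g ⋆ h) n) + (tail f ⋆ (g ⋆ h)) n
      ≈⟨ +-congʳ (*-congˡ (⋆-sucˡ g h n)) ⟨
    f 0 * (g ⋆ h) (suc n) + (tail f ⋆ (g ⋆ h)) n
      ≈⟨ ⋆-sucˡ f (g ⋆ h) n ⟨
    (f ⋆ (g ⋆ h)) (suc n) ∎

  seriesRing : CommutativeRing c ℓ
  seriesRing = record
    { RawRing (PowerSeries.rawRing A)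
    ; isCommutativeRing = record
      { isRing = record
        { +-isAbelianGroup = record
          { isGroup = record
            { isMonoid = record
              { isSemigroup = record
                { isMagma = record
                  { isEquivalence = record
                    { refl  = λ _ → refl
                    ; sym   = λ f≈g n → sym (f≈g n)
                    ; trans = λ f≈g g≈h n → trans (f≈g n) (g≈h n)
                    }
                  ; ∙-cong = λ f≈f′ g≈g′ n → +-cong (f≈f′ n) (g≈g′ n)
                  }
                ; assoc = λ f g h n → +-assoc (f n) (g n) (h n)
                }
              ; identity = (λ f n → +-identityˡ (f n)) , (λ f n → +-identityʳ (f n))
              }
            ; inverse = (λ f n → -‿inverseˡ (f n)) , (λ f n → -‿inverseʳ (f n))
            ; ⁻¹-cong = λ f≈g n → -‿cong (f≈g n)
            }
          ; comm = λ f g n → +-comm (f n) (g n)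
          }
        ; *-cong = λ {f} {f′} {g} {g′} → ⋆-cong {f} {f′} {g} {g′}
        ; *-assoc = ⋆-assoc
        ; *-identity = ⋆-identityˡ , λ f n → trans (⋆-comm f one n) (⋆-identityˡ f n)
        ; distrib = ⋆-distribˡ , ⋆-distribʳ
        }
      ; *-comm = ⋆-comm
      }
    }

-- The power rule for derivations.

module Derivation {c ℓ} (R : CommutativeRing c ℓ) where
  open CommutativeRing R hiding (zero)
  open import Algebra.Properties.Semiring.Mult semiring using () renaming (_×_ to _×ₙ_; ×-comm-* to ×ₙ-comm-*; ×-congʳ to ×ₙ-congʳ)
  open RawSemiringDefinitions (RawRing.rawSemiring rawRing) using (_^_)
  open import Relation.Binary.Reasoning.Setoid setoid

  -- Stated for an abstract `D` because it serves both `θ` and `L`. The exponent `suc k` spares a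
  -- truncated subtraction on the right.
  D-^ : (D : Carrier → Carrier) →
        (∀ f g → D (f * g) ≈ D f * g + f * D g) → D 1# ≈ 0# →
        ∀ f k → D (f ^ suc k) ≈ suc k ×ₙ (f ^ k * D f)
  D-^ D leibniz D1≈0 f zero = begin
    D (f * 1#)             ≈⟨ leibniz f 1# ⟩
    D f * 1# + f * D 1#    ≈⟨ +-cong (*-comm _ _) (trans (*-congˡ D1≈0) (zeroʳ f)) ⟩
    1# * D f + 0#          ∎
  D-^ D leibniz D1≈0 f (suc k) = begin
    D (f * f ^ suc k)
      ≈⟨ leibniz f (f ^ suc k) ⟩
    D f * f ^ suc k + f * D (f ^ suc k)
      ≈⟨ +-cong (*-comm _ _) (*-congˡ (D-^ D leibniz D1≈0 f k)) ⟩
    f ^ suc k * D f + f * (suc k ×ₙ (f ^ k * D f))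
      ≈⟨ +-congˡ (×ₙ-comm-* (suc k) f _) ⟩
    f ^ suc k * D f + suc k ×ₙ (f * (f ^ k * D f))
      ≈⟨ +-congˡ (×ₙ-congʳ (suc k) (*-assoc f (f ^ k) (D f))) ⟨
    f ^ suc k * D f + suc k ×ₙ (f ^ suc k * D f) ∎

-- Integers and inverse factorials in a ring containing ℚ.

module FromRationals {c ℓ} (R : CommutativeRing c ℓ)
  (ι : ℚ → CommutativeRing.Carrier R)
  (ι-hom : IsRingHomomorphism ℚ.+-*-rawRing (CommutativeRing.rawRing R) ι) where
  open CommutativeRing R hiding (zero) renaming (rawRing to A)
  open IsRingHomomorphism ι-hom using (+-homo; *-homo; 0#-homo; 1#-homo)
  open Degenerate A ι using (fromℕ; 1/_; 1/!_)
  open import Algebra.Solver.Ring.NaturalCoefficients.Default commutativeSemiring using (solve; _:=_; _:*_)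
  open import Algebra.Properties.Semiring.Mult semiring using () renaming (_×_ to _×ₙ_)
  open import Relation.Binary.Reasoning.Setoid setoid

  fromℕ-0 : fromℕ 0 ≈ 0#
  fromℕ-0 = 0#-homo

  fromℕ-1 : fromℕ 1 ≈ 1#
  fromℕ-1 = 1#-homo

  fromℕ-+ : ∀ m n → fromℕ (m ℕ.+ n) ≈ fromℕ m + fromℕ n
  fromℕ-+ m n = trans (reflexive (≡.cong ι ([m+n]/1 m n))) (+-homo _ _)

  fromℕ-* : ∀ m n → fromℕ (m ℕ.* n) ≈ fromℕ m * fromℕ n
  fromℕ-* m n = trans (reflexive (≡.cong ι ([m*n]/1 m n))) (*-homo _ _)

  fromℕ-suc : ∀ n → fromℕ (suc n) ≈ 1# + fromℕ n
  fromℕ-suc n = trans (fromℕ-+ 1 n) (+-congʳ fromℕ-1)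

  ×≈fromℕ* : ∀ n a → n ×ₙ a ≈ fromℕ n * a
  ×≈fromℕ* zero    a = sym (trans (*-congʳ fromℕ-0) (zeroˡ a))
  ×≈fromℕ* (suc n) a = begin
    a + n ×ₙ a              ≈⟨ +-cong (sym (*-identityˡ a)) (×≈fromℕ* n a) ⟩
    1# * a + fromℕ n * a    ≈⟨ distribʳ a _ _ ⟨
    (1# + fromℕ n) * a      ≈⟨ *-congʳ (fromℕ-suc n) ⟨
    fromℕ (suc n) * a       ∎

  1/-inverse : ∀ n .{{_ : NonZero n}} → 1/ n * fromℕ n ≈ 1#
  1/-inverse n = begin
    1/ n * fromℕ n               ≈⟨ *-homo _ _ ⟨
    ι ((+ 1 / n) ℚ.* (+ n / 1))  ≈⟨ reflexive (≡.cong ι (1/n*n/1 n)) ⟩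
    ι 1ℚ                         ≈⟨ 1#-homo ⟩
    1#                           ∎

  1/!-inverse : ∀ n → 1/! n * fromℕ (n !) ≈ 1#
  1/!-inverse n = 1/-inverse (n !) {{n !≢0}}

  -- `1/!` is the image of a single fraction and has no recursion to unfold, so this is uniqueness
  -- of inverses: once `1/! n * fromℕ (n !)` is inserted, the factor (n+1)! can be assembled and
  -- cancelled.
  1/!-suc : ∀ n → fromℕ (suc n) * 1/! (suc n) ≈ 1/! n
  1/!-suc n = begin
    fromℕ (suc n) * 1/! (suc n)
      ≈⟨ *-identityˡ _ ⟨
    1# * (fromℕ (suc n) * 1/! (suc n))
      ≈⟨ *-congʳ (1/!-inverse n) ⟨
    1/! n * fromℕ (n !) * (fromℕ (suc n) * 1/! (suc n))
      ≈⟨ solve 4 (λ a b c d → a :* b :* (c :* d) := a :* (d :* (c :* b))) refl (1/! n) (fromℕ (n !)) (fromℕ (suc n)) (1/! (suc n)) ⟩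
    1/! n * (1/! (suc n) * (fromℕ (suc n) * fromℕ (n !)))
      ≈⟨ *-congˡ (*-congˡ (fromℕ-* (suc n) (n !))) ⟨
    1/! n * (1/! (suc n) * fromℕ (suc n !))
      ≈⟨ *-congˡ (1/!-inverse (suc n)) ⟩
    1/! n * 1#
      ≈⟨ *-identityʳ _ ⟩
    1/! n ∎

-- Uniqueness of the degenerate Stirling numbers.

module StirlingUniqueness {c ℓ} (R : CommutativeRing c ℓ)
  (ι : ℚ → CommutativeRing.Carrier R)
  (ι-hom : IsRingHomomorphism ℚ.+-*-rawRing (CommutativeRing.rawRing R) ι) where
  open CommutativeRing R hiding (zero) renaming (rawRing to A)
  open Degenerate A ι using (fromℕ; 1/!_; falling; IsDegStirling₂)
  open FromRationals R ι ι-hom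
  open Sums R
  open import Algebra.Properties.Ring ring using (-0#≈0#; -‿+-comm; +-cancelˡ)
  open import Algebra.Properties.CommutativeSemigroup +-commutativeSemigroup using (interchange)
  open import Algebra.Properties.CommutativeSemigroup *-commutativeSemigroup using () renaming (x∙yz≈xz∙y to x*yz≈xz*y)
  open import Relation.Binary.Reasoning.Setoid setoid

  falling-cong : ∀ {x y} k → x ≈ y → falling x k ≈ falling y k
  falling-cong zero    x≈y = refl
  falling-cong (suc k) x≈y = *-cong (falling-cong k x≈y) (+-congʳ x≈y)

  -- The definition of `falling` splits off the last factor. Splitting off the first instead lowers
  -- argument and length together, which is the induction behind `falling-diagonal`.
  falling-1+ : ∀ y k → falling (1# + y) (suc k) ≈ (1# + y) * falling y k
  falling-1+ y zero = begin
    1# * ((1# + y) - fromℕ 0)  ≈⟨ *-comm _ _ ⟩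
    ((1# + y) - fromℕ 0) * 1#  ≈⟨ *-congʳ (+-congˡ (trans (-‿cong fromℕ-0) -0#≈0#)) ⟩
    ((1# + y) + 0#) * 1#       ≈⟨ *-congʳ (+-identityʳ _) ⟩
    (1# + y) * 1#              ∎
  falling-1+ y (suc k) = begin
    falling (1# + y) (suc k) * ((1# + y) - fromℕ (suc k))  ≈⟨ *-cong (falling-1+ y k) shift ⟩
    (1# + y) * falling y k * (y - fromℕ k)                 ≈⟨ *-assoc _ _ _ ⟩
    (1# + y) * falling y (suc k)                           ∎
    where
    shift : (1# + y) - fromℕ (suc k) ≈ y - fromℕ k
    shift = begin
      (1# + y) - fromℕ (suc k)         ≈⟨ +-congˡ (-‿cong (fromℕ-suc k)) ⟩
      (1# + y) - (1# + fromℕ k)        ≈⟨ +-congˡ (-‿+-comm 1# (fromℕ k)) ⟨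
      (1# + y) + (- 1# + - fromℕ k)    ≈⟨ interchange 1# y (- 1#) (- fromℕ k) ⟩
      (1# - 1#) + (y - fromℕ k)        ≈⟨ +-congʳ (-‿inverseʳ 1#) ⟩
      0# + (y - fromℕ k)               ≈⟨ +-identityˡ _ ⟩
      y - fromℕ k                      ∎

  falling-diagonal : ∀ k → falling (fromℕ k) k ≈ fromℕ (k !)
  falling-diagonal zero    = sym fromℕ-1
  falling-diagonal (suc k) = begin
    falling (fromℕ (suc k)) (suc k)     ≈⟨ falling-cong (suc k) (fromℕ-suc k) ⟩
    falling (1# + fromℕ k) (suc k)      ≈⟨ falling-1+ (fromℕ k) k ⟩
    (1# + fromℕ k) * falling (fromℕ k) k ≈⟨ *-cong (sym (fromℕ-suc k)) (falling-diagonal k) ⟩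
    fromℕ (suc k) * fromℕ (k !)         ≈⟨ fromℕ-* (suc k) (k !) ⟨
    fromℕ (suc k !)                     ∎

  falling-vanishes : ∀ m k → m < k → falling (fromℕ m) k ≈ 0#
  falling-vanishes m (suc k) (s≤s m≤k) with ℕₚ.m≤n⇒m<n∨m≡n m≤k
  ... | inj₁ m<k    = trans (*-congʳ (falling-vanishes m k m<k)) (zeroˡ _)
  ... | inj₂ ≡.refl = trans (*-congˡ (-‿inverseʳ (fromℕ m))) (zeroʳ _)

  -- A triangular system: at x = m the terms with k > m vanish, those with k < m agree by induction,
  -- and the term k = m carries the factor m!, which is invertible.
  falling-independent : ∀ N (a b : ℕ → Carrier) →
    (∀ x → ∑ N (λ k → a k * falling x k) ≈ ∑ N (λ k → b k * falling x k)) →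
    ∀ m → m ≤ N → ∀ k → k < m → a k ≈ b k
  falling-independent N a b a≈b (suc m) m<N k (s≤s k≤m) with ℕₚ.m≤n⇒m<n∨m≡n k≤m
  ... | inj₁ k<m    = falling-independent N a b a≈b m (ℕₚ.<⇒≤ m<N) k k<m
  ... | inj₂ ≡.refl = begin
    a m                                ≈⟨ cancel (a m) ⟨
    a m * fromℕ (m !) * 1/! m          ≈⟨ *-congʳ (*-congˡ (falling-diagonal m)) ⟨
    a m * falling (fromℕ m) m * 1/! m  ≈⟨ *-congʳ (+-cancelˡ _ _ _ leading) ⟩
    b m * falling (fromℕ m) m * 1/! m  ≈⟨ *-congʳ (*-congˡ (falling-diagonal m)) ⟩
    b m * fromℕ (m !) * 1/! m          ≈⟨ cancel (b m) ⟩
    b m                                ∎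
    where
    cancel : ∀ c → c * fromℕ (m !) * 1/! m ≈ c
    cancel c = begin
      c * fromℕ (m !) * 1/! m    ≈⟨ x*yz≈xz*y c (1/! m) (fromℕ (m !)) ⟨
      c * (1/! m * fromℕ (m !))  ≈⟨ *-congˡ (1/!-inverse m) ⟩
      c * 1#                     ≈⟨ *-identityʳ c ⟩
      c                          ∎

    truncate : ∀ c → ∑ (suc m) (λ k → c k * falling (fromℕ m) k) ≈ ∑ N (λ k → c k * falling (fromℕ m) k)
    truncate c = ∑-extend _ m<N λ i m<i → trans (*-congˡ (falling-vanishes m i m<i)) (zeroʳ _)

    leading : ∑ m (λ k → b k * falling (fromℕ m) k) + a m * falling (fromℕ m) m ≈
              ∑ m (λ k → b k * falling (fromℕ m) k) + b m * falling (fromℕ m) m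
    leading = begin
      ∑ m (λ k → b k * falling (fromℕ m) k) + a m * falling (fromℕ m) m
        ≈⟨ +-congʳ (∑-cong m λ k k<m → *-congʳ (falling-independent N a b a≈b m (ℕₚ.<⇒≤ m<N) k k<m)) ⟨
      ∑ (suc m) (λ k → a k * falling (fromℕ m) k)  ≈⟨ truncate a ⟩
      ∑ N (λ k → a k * falling (fromℕ m) k)        ≈⟨ a≈b (fromℕ m) ⟩
      ∑ N (λ k → b k * falling (fromℕ m) k)        ≈⟨ truncate b ⟨
      ∑ (suc m) (λ k → b k * falling (fromℕ m) k)  ∎

  degStirling₂-unique : ∀ lam S T → IsDegStirling₂ lam S → IsDegStirling₂ lam T →
                        ∀ n k → k ≤ n → S n k ≈ T n k
  degStirling₂-unique lam S T S-isStirling T-isStirling n k k≤n =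
    falling-independent (suc n) (S n) (T n)
      (λ x → trans (sym (S-isStirling n x)) (T-isStirling n x))
      (suc n) ℕₚ.≤-refl k (s≤s k≤n)

-- The generating functions and the identity over a general ring.

module DegenerateSeries {c ℓ} (R : CommutativeRing c ℓ)
  (ι : ℚ → CommutativeRing.Carrier R)
  (ι-hom : IsRingHomomorphism ℚ.+-*-rawRing (CommutativeRing.rawRing R) ι)
  (lam : CommutativeRing.Carrier R) where
  open CommutativeRing R hiding (zero) renaming (rawRing to A)
  open Degenerate A ι using (fromℕ; 1/_; 1/!_; degFalling; degExp; degExp-1; t/[degExp-1]; exp; bernoulli; bell)
  open FromRationals R ι ι-hom
  open Sums R
  open FormalSeries R
  open Existence R using (⊘-correct)
  private module P = CommutativeRing seriesRing
  open RawSemiringDefinitions (RawRing.rawSemiring A) using (_^_)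
  open RawSemiringDefinitions (RawRing.rawSemiring (PowerSeries.rawRing A)) using () renaming (_^_ to _^ᵗ_)
  open import Algebra.Properties.Semiring.Mult P.semiring using () renaming (_×_ to _×ᵗ_)
  open import Algebra.Properties.Semiring.Mult semiring using () renaming (_×_ to _×ₙ_)
  open import Algebra.Properties.Ring ring using (-‿+-comm; -0#≈0#; -‿distribʳ-*)
  open import Algebra.Solver.Ring.NaturalCoefficients.Default commutativeSemiring using (solve; _:=_; _:+_; _:*_)
  open import Relation.Binary.Reasoning.Setoid setoid

  θ : Series → Series
  θ f n = fromℕ n * f n

  θ-0 : ∀ f → θ f 0 ≈ 0#
  θ-0 f = trans (*-congʳ fromℕ-0) (zeroˡ _)

  θ-one : θ one ≗ λ _ → 0#
  θ-one zero    = θ-0 one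
  θ-one (suc n) = zeroʳ _

  -- On each term of the Cauchy product the weight n splits as i + (n - i).
  θ-leibniz : ∀ f g → θ (f ⋆ g) ≗ λ n → (θ f ⋆ g) n + (f ⋆ θ g) n
  θ-leibniz f g n = begin
    fromℕ n * ∑ (suc n) (λ i → f i * g (n ∸ i))
      ≈⟨ ∑-*ˡ (suc n) _ _ ⟩
    ∑ (suc n) (λ i → fromℕ n * (f i * g (n ∸ i)))
      ≈⟨ ∑-cong (suc n) (λ i i<1+n → split i (ℕₚ.≤-pred i<1+n)) ⟩
    ∑ (suc n) (λ i → θ f i * g (n ∸ i) + f i * θ g (n ∸ i))
      ≈⟨ ∑-+ (suc n) _ _ ⟩
    (θ f ⋆ g) n + (f ⋆ θ g) n ∎
    where
    split : ∀ i → i ≤ n → fromℕ n * (f i * g (n ∸ i)) ≈ θ f i * g (n ∸ i) + f i * θ g (n ∸ i)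
    split i i≤n = begin
      fromℕ n * (f i * g (n ∸ i))
        ≈⟨ *-congʳ (reflexive (≡.cong fromℕ (ℕₚ.m+[n∸m]≡n i≤n))) ⟨
      fromℕ (i ℕ.+ (n ∸ i)) * (f i * g (n ∸ i))
        ≈⟨ *-congʳ (fromℕ-+ i (n ∸ i)) ⟩
      (fromℕ i + fromℕ (n ∸ i)) * (f i * g (n ∸ i))
        ≈⟨ solve 4 (λ a b x y → (a :+ b) :* (x :* y) := a :* x :* y :+ x :* (b :* y)) refl (fromℕ i) (fromℕ (n ∸ i)) (f i) (g (n ∸ i)) ⟩
      θ f i * g (n ∸ i) + f i * θ g (n ∸ i) ∎

  tail-⋆ˡ : ∀ f g → f 0 ≈ 0# → tail (f ⋆ g) ≗ tail f ⋆ g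
  tail-⋆ˡ f g f₀≈0 n = begin
    (f ⋆ g) (suc n)                   ≈⟨ ⋆-sucˡ f g n ⟩
    f 0 * g (suc n) + (tail f ⋆ g) n  ≈⟨ +-congʳ (trans (*-congʳ f₀≈0) (zeroˡ _)) ⟩
    0# + (tail f ⋆ g) n               ≈⟨ +-identityˡ _ ⟩
    (tail f ⋆ g) n                    ∎

  tail-⋆ʳ : ∀ f g → g 0 ≈ 0# → tail (f ⋆ g) ≗ f ⋆ tail g
  tail-⋆ʳ f g g₀≈0 n = begin
    (f ⋆ g) (suc n)                   ≈⟨ ⋆-sucʳ f g n ⟩
    (f ⋆ tail g) n + f (suc n) * g 0  ≈⟨ +-congˡ (trans (*-congˡ g₀≈0) (zeroʳ _)) ⟩
    (f ⋆ tail g) n + 0#               ≈⟨ +-identityʳ _ ⟩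
    (f ⋆ tail g) n                    ∎

  -- (1 + λt) d/dt
  L : Series → Series
  L f n = θ f (suc n) + lam * θ f n

  L-one : L one ≗ λ _ → 0#
  L-one n = begin
    θ one (suc n) + lam * θ one n  ≈⟨ +-cong (θ-one (suc n)) (trans (*-congˡ (θ-one n)) (zeroʳ lam)) ⟩
    0# + 0#                        ≈⟨ +-identityʳ 0# ⟩
    0#                             ∎

  -- d/dt is `tail` after `θ`. Any `θ f` has constant coefficient 0, so in each summand of the
  -- Leibniz rule for `θ` the division by t can be moved onto the factor that carries `θ`.
  L-leibniz : ∀ f g → L (f ⋆ g) ≗ λ n → (L f ⋆ g) n + (f ⋆ L g) n
  L-leibniz f g n = begin
    θ (f ⋆ g) (suc n) + lam * θ (f ⋆ g) n
      ≈⟨ +-cong (θ-leibniz f g (suc n)) (*-congˡ (θ-leibniz f g n)) ⟩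
    ((θ f ⋆ g) (suc n) + (f ⋆ θ g) (suc n)) + lam * ((θ f ⋆ g) n + (f ⋆ θ g) n)
      ≈⟨ +-congʳ (+-cong (tail-⋆ˡ (θ f) g (θ-0 f) n) (tail-⋆ʳ f (θ g) (θ-0 g) n)) ⟩
    ((tail (θ f) ⋆ g) n + (f ⋆ tail (θ g)) n) + lam * ((θ f ⋆ g) n + (f ⋆ θ g) n)
      ≈⟨ solve 5 (λ a b l c d → (a :+ b) :+ l :* (c :+ d) := (a :+ l :* c) :+ (b :+ l :* d)) refl
           ((tail (θ f) ⋆ g) n) ((f ⋆ tail (θ g)) n) lam ((θ f ⋆ g) n) ((f ⋆ θ g) n) ⟩
    ((tail (θ f) ⋆ g) n + lam * (θ f ⋆ g) n) + ((f ⋆ tail (θ g)) n + lam * (f ⋆ θ g) n)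
      ≈⟨ +-cong (+-congˡ (sym (⋆-·ˡ lam (θ f) g n))) (+-congˡ (sym (⋆-·ʳ n))) ⟩
    ((tail (θ f) ⋆ g) n + ((lam · θ f) ⋆ g) n) + ((f ⋆ tail (θ g)) n + (f ⋆ (lam · θ g)) n)
      ≈⟨ +-cong (⋆-distribʳ g (tail (θ f)) (lam · θ f) n) (⋆-distribˡ f (tail (θ g)) (lam · θ g) n) ⟨
    (L f ⋆ g) n + (f ⋆ L g) n ∎
    where
    ⋆-·ʳ : f ⋆ (lam · θ g) ≗ lam · (f ⋆ θ g)
    ⋆-·ʳ m = trans (⋆-comm f (lam · θ g) m)
      (trans (⋆-·ˡ lam (θ g) f m) (*-congˡ (⋆-comm (θ g) f m)))

  ×ᵗ-coefficient : ∀ k f n → (k ×ᵗ f) n ≈ fromℕ k * f n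
  ×ᵗ-coefficient k f n = trans (pointwise k) (×≈fromℕ* k (f n))
    where
    pointwise : ∀ k → (k ×ᵗ f) n ≈ k ×ₙ f n
    pointwise zero    = refl
    pointwise (suc k) = +-congˡ (pointwise k)

  -- The origin of the argument 1-λ: for y = 1 the first factor is 1 and what remains is the falling
  -- factorial of 1-λ.
  degFalling-suc : ∀ y k → degFalling lam y (suc k) ≈ y * degFalling lam (y - lam) k
  degFalling-suc y zero = begin
    1# * (y - fromℕ 0 * lam)  ≈⟨ *-comm _ _ ⟩
    (y - fromℕ 0 * lam) * 1#  ≈⟨ *-congʳ (+-congˡ (-‿cong (trans (*-congʳ fromℕ-0) (zeroˡ lam)))) ⟩
    (y - 0#) * 1#             ≈⟨ *-congʳ (trans (+-congˡ -0#≈0#) (+-identityʳ y)) ⟩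
    y * 1#                    ∎
  degFalling-suc y (suc k) = begin
    degFalling lam y (suc k) * (y - fromℕ (suc k) * lam)        ≈⟨ *-cong (degFalling-suc y k) shift ⟩
    y * degFalling lam (y - lam) k * ((y - lam) - fromℕ k * lam) ≈⟨ *-assoc _ _ _ ⟩
    y * degFalling lam (y - lam) (suc k)                        ∎
    where
    shift : y - fromℕ (suc k) * lam ≈ (y - lam) - fromℕ k * lam
    shift = begin
      y - fromℕ (suc k) * lam            ≈⟨ +-congˡ (-‿cong (*-congʳ (fromℕ-suc k))) ⟩
      y - (1# + fromℕ k) * lam           ≈⟨ +-congˡ (-‿cong (trans (distribʳ lam 1# (fromℕ k)) (+-congʳ (*-identityˡ lam)))) ⟩
      y - (lam + fromℕ k * lam)          ≈⟨ +-congˡ (-‿+-comm lam (fromℕ k * lam)) ⟨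
      y + (- lam + - (fromℕ k * lam))    ≈⟨ +-assoc y (- lam) _ ⟨
      (y - lam) - fromℕ k * lam          ∎

  u : Series
  u = degExp-1 lam

  one+u : ∀ n → one n + u n ≈ degExp lam 1# n
  one+u n = begin
    one n + (degExp lam 1# n - one n)  ≈⟨ +-comm _ _ ⟩
    (degExp lam 1# n - one n) + one n  ≈⟨ +-assoc _ _ _ ⟩
    degExp lam 1# n + (- one n + one n) ≈⟨ +-congˡ (-‿inverseˡ _) ⟩
    degExp lam 1# n + 0#               ≈⟨ +-identityʳ _ ⟩
    degExp lam 1# n                    ∎

  θu : ∀ n → θ u n ≈ θ (degExp lam 1#) n
  θu n = begin
    fromℕ n * u n                  ≈⟨ +-identityˡ _ ⟨
    0# + fromℕ n * u n             ≈⟨ +-congʳ (θ-one n) ⟨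
    fromℕ n * one n + fromℕ n * u n ≈⟨ distribˡ _ _ _ ⟨
    fromℕ n * (one n + u n)        ≈⟨ *-congˡ (one+u n) ⟩
    fromℕ n * degExp lam 1# n      ∎

  u₀≈0 : u 0 ≈ 0#
  u₀≈0 = begin
    1# * 1/! 0 - 1#  ≈⟨ +-congʳ (trans (*-identityˡ _) fromℕ-1) ⟩
    1# - 1#          ≈⟨ -‿inverseʳ 1# ⟩
    0#               ∎

  θu-suc : ∀ n → θ u (suc n) ≈ degFalling lam 1# (suc n) * 1/! n
  θu-suc n = begin
    θ u (suc n)
      ≈⟨ θu (suc n) ⟩
    fromℕ (suc n) * (degFalling lam 1# (suc n) * 1/! (suc n))
      ≈⟨ solve 3 (λ a b c → a :* (b :* c) := b :* (a :* c)) refl (fromℕ (suc n)) (degFalling lam 1# (suc n)) (1/! (suc n)) ⟩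
    degFalling lam 1# (suc n) * (fromℕ (suc n) * 1/! (suc n))
      ≈⟨ *-congˡ (1/!-suc n) ⟩
    degFalling lam 1# (suc n) * 1/! n ∎

  -- u′ = e_λ^{1-λ}
  θu-degExp : ∀ n → θ u (suc n) ≈ degExp lam (1# - lam) n
  θu-degExp n = trans (θu-suc n) (*-congʳ (trans (degFalling-suc 1# n) (*-identityˡ _)))

  -- e_λ is fixed by `L`: passing from (1)_{n,λ} to (1)_{n+1,λ} brings the factor 1 - nλ, and the
  -- part -nλ is cancelled by the summand `lam * θ u n`.
  Lu≈one+u : L u ≗ λ n → one n + u n
  Lu≈one+u n = begin
    θ u (suc n) + lam * θ u n
      ≈⟨ +-cong (θu-suc n) (*-congˡ (θu n)) ⟩
    d * (1# - k * lam) * e + lam * (k * (d * e))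
      ≈⟨ solve 6 (λ d e k l m i → d :* (i :+ m) :* e :+ l :* (k :* (d :* e)) := d :* e :* (i :+ (m :+ k :* l))) refl
           d e k lam (- (k * lam)) 1# ⟩
    d * e * (1# + (- (k * lam) + k * lam))
      ≈⟨ *-congˡ (trans (+-congˡ (-‿inverseˡ _)) (+-identityʳ 1#)) ⟩
    d * e * 1#
      ≈⟨ *-identityʳ _ ⟩
    d * e
      ≈⟨ one+u n ⟨
    one n + u n ∎
    where
    d e k : Carrier
    d = degFalling lam 1# n
    e = 1/! n
    k = fromℕ n

  -- The generating function ∑ β_{n,λ}(1-λ) tⁿ/n!.
  w : Series
  w = t/[degExp-1] lam ⋆ degExp lam (1# - lam)

  tail-u₀≈1 : tail u 0 ≈ 1#
  tail-u₀≈1 = begin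
    u 1                                      ≈⟨ *-identityˡ _ ⟨
    1# * u 1                                 ≈⟨ *-congʳ fromℕ-1 ⟨
    θ u 1                                    ≈⟨ θu-degExp 0 ⟩
    1# * 1/! 0                               ≈⟨ trans (*-identityˡ _) fromℕ-1 ⟩
    1#                                       ∎

  -- `t/[degExp-1] lam` unfolds to `one ⊘ tail u`. The constant coefficient of `tail u` is 1, so
  -- long division yields a true inverse of `tail u`.
  w⋆tail-u : w ⋆ tail u ≗ degExp lam (1# - lam)
  w⋆tail-u n = begin
    ((q ⋆ E) ⋆ tail u) n   ≈⟨ ⋆-comm (q ⋆ E) (tail u) n ⟩
    (tail u ⋆ (q ⋆ E)) n   ≈⟨ ⋆-assoc (tail u) q E n ⟨
    ((tail u ⋆ q) ⋆ E) n   ≈⟨ ⋆-cong {g = E} (⊘-correct one (tail u) tail-u₀≈1) (λ _ → refl) n ⟩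
    (one ⋆ E) n            ≈⟨ ⋆-identityˡ E n ⟩
    E n                    ∎
    where
    q E : Series
    q = t/[degExp-1] lam
    E = degExp lam (1# - lam)

  θu≈w⋆u : θ u ≗ w ⋆ u
  θu≈w⋆u zero    = begin
    θ u 0          ≈⟨ θ-0 u ⟩
    0#             ≈⟨ trans (*-congˡ u₀≈0) (zeroʳ _) ⟨
    w 0 * u 0      ≈⟨ +-identityˡ _ ⟨
    0# + w 0 * u 0 ∎
  θu≈w⋆u (suc n) = begin
    θ u (suc n)             ≈⟨ θu-degExp n ⟩
    degExp lam (1# - lam) n ≈⟨ w⋆tail-u n ⟨
    (w ⋆ tail u) n          ≈⟨ tail-⋆ʳ w u u₀≈0 n ⟨
    (w ⋆ u) (suc n)         ∎

  θ-u^ : ∀ k n → fromℕ n * (u ^ᵗ suc k) n ≈ fromℕ (suc k) * (w ⋆ u ^ᵗ suc k) n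
  θ-u^ k n = begin
    θ (u ^ᵗ suc k) n
      ≈⟨ Derivation.D-^ seriesRing θ θ-leibniz θ-one u k n ⟩
    (suc k ×ᵗ (u ^ᵗ k ⋆ θ u)) n
      ≈⟨ ×ᵗ-coefficient (suc k) (u ^ᵗ k ⋆ θ u) n ⟩
    fromℕ (suc k) * (u ^ᵗ k ⋆ θ u) n
      ≈⟨ *-congˡ (⋆-cong {f = u ^ᵗ k} (λ _ → refl) θu≈w⋆u n) ⟩
    fromℕ (suc k) * (u ^ᵗ k ⋆ (w ⋆ u)) n
      ≈⟨ *-congˡ (⋆-comm (u ^ᵗ k) (w ⋆ u) n) ⟩
    fromℕ (suc k) * ((w ⋆ u) ⋆ u ^ᵗ k) n
      ≈⟨ *-congˡ (⋆-assoc w u (u ^ᵗ k) n) ⟩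
    fromℕ (suc k) * (w ⋆ u ^ᵗ suc k) n ∎

  L-u^ : ∀ k n → L (u ^ᵗ suc k) n ≈ fromℕ (suc k) * ((u ^ᵗ k) n + (u ^ᵗ suc k) n)
  L-u^ k n = begin
    L (u ^ᵗ suc k) n
      ≈⟨ Derivation.D-^ seriesRing L L-leibniz L-one u k n ⟩
    (suc k ×ᵗ (u ^ᵗ k ⋆ L u)) n
      ≈⟨ ×ᵗ-coefficient (suc k) (u ^ᵗ k ⋆ L u) n ⟩
    fromℕ (suc k) * (u ^ᵗ k ⋆ L u) n
      ≈⟨ *-congˡ (⋆-cong {f = u ^ᵗ k} (λ _ → refl) Lu≈one+u n) ⟩
    fromℕ (suc k) * (u ^ᵗ k ⋆ (λ m → one m + u m)) n
      ≈⟨ *-congˡ (⋆-distribˡ (u ^ᵗ k) one u n) ⟩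
    fromℕ (suc k) * ((u ^ᵗ k ⋆ one) n + (u ^ᵗ k ⋆ u) n)
      ≈⟨ *-congˡ (+-cong (P.*-identityʳ (u ^ᵗ k) n) (⋆-comm (u ^ᵗ k) u n)) ⟩
    fromℕ (suc k) * ((u ^ᵗ k) n + (u ^ᵗ suc k) n) ∎

  -- u is divisible by t, hence uᵏ by tᵏ. All truncations of sums over powers of u rest on this.
  u^-vanishes : ∀ k n → n < k → (u ^ᵗ k) n ≈ 0#
  u^-vanishes (suc k) zero    _         =
    trans (+-identityˡ _) (trans (*-congʳ u₀≈0) (zeroˡ _))
  u^-vanishes (suc k) (suc n) (s≤s n<k) = begin
    (u ⋆ u ^ᵗ k) (suc n)   ≈⟨ tail-⋆ˡ u (u ^ᵗ k) u₀≈0 n ⟩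
    (tail u ⋆ u ^ᵗ k) n    ≈⟨ ∑-zero (suc n) (λ i _ → trans (*-congˡ (u^-vanishes k (n ∸ i) (ℕₚ.≤-<-trans (ℕₚ.m∸n≤m n i) n<k))) (zeroʳ _)) ⟩
    0#                     ∎

  S : ℕ → ℕ → Carrier
  S = proj₁ (Existence.degStirling₂-exists R ι lam)

  -- The recurrence defining S holds definitionally.
  S-egf : ∀ n k → S n k * fromℕ (k !) ≈ fromℕ (n !) * (u ^ᵗ k) n
  S-egf zero    zero    = *-comm 1# (fromℕ 1)
  S-egf zero    (suc k) = trans (zeroˡ _) (sym (trans (*-congˡ (u^-vanishes (suc k) 0 z<s)) (zeroʳ _)))
  S-egf (suc n) zero    = begin
    S n 0 * (fromℕ 0 - fromℕ n * lam) * fromℕ 1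
      ≈⟨ solve 3 (λ a b c → a :* b :* c := a :* c :* b) refl (S n 0) (fromℕ 0 - fromℕ n * lam) (fromℕ 1) ⟩
    S n 0 * fromℕ 1 * (fromℕ 0 - fromℕ n * lam)
      ≈⟨ *-cong (S-egf n 0) (trans (+-congʳ fromℕ-0) (+-identityˡ _)) ⟩
    fromℕ (n !) * one n * - (fromℕ n * lam)
      ≈⟨ -‿distribʳ-* _ _ ⟨
    - (fromℕ (n !) * one n * (fromℕ n * lam))
      -- Moving `fromℕ n` next to `one n` exposes `θ one n`, which is zero through its weight at n =
      -- 0 and through its coefficient elsewhere.
      ≈⟨ -‿cong (solve 4 (λ a b c d → a :* b :* (c :* d) := a :* d :* (c :* b)) refl (fromℕ (n !)) (one n) (fromℕ n) lam) ⟩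
    - (fromℕ (n !) * lam * (fromℕ n * one n))
      ≈⟨ -‿cong (trans (*-congˡ (θ-one n)) (zeroʳ _)) ⟩
    - 0#
      ≈⟨ -0#≈0# ⟩
    0#
      ≈⟨ zeroʳ _ ⟨
    fromℕ (suc n !) * 0# ∎
  S-egf (suc n) (suc k) = begin
    (S n (suc k) * (κ - ν * lam) + S n k) * fromℕ (suc k !)
      ≈⟨ distribʳ _ _ _ ⟩
    S n (suc k) * (κ - ν * lam) * fromℕ (suc k !) + S n k * fromℕ (suc k !)
      ≈⟨ +-congˡ (*-congˡ (fromℕ-* (suc k) (k !))) ⟩
    S n (suc k) * (κ - ν * lam) * fromℕ (suc k !) + S n k * (κ * fromℕ (k !))
      ≈⟨ solve 6 (λ a b c d e f → a :* b :* c :+ d :* (e :* f) := a :* c :* b :+ d :* f :* e) refl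
           (S n (suc k)) (κ - ν * lam) (fromℕ (suc k !)) (S n k) κ (fromℕ (k !)) ⟩
    S n (suc k) * fromℕ (suc k !) * (κ - ν * lam) + S n k * fromℕ (k !) * κ
      ≈⟨ +-cong (*-congʳ (S-egf n (suc k))) (*-congʳ (S-egf n k)) ⟩
    fromℕ (n !) * b * (κ - ν * lam) + fromℕ (n !) * a * κ
      ≈⟨ solve 5 (λ f a b κ m → f :* b :* (κ :+ m) :+ f :* a :* κ := f :* (κ :* (a :+ b) :+ b :* m)) refl
           (fromℕ (n !)) a b κ (- (ν * lam)) ⟩
    fromℕ (n !) * (κ * (a + b) + b * - (ν * lam))
      -- Read backwards, `L-u^` replaces (k+1)(a + b) by (n+1) b′ + λ n b; the second term cancels
      -- the -nλ of the recurrence.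
      ≈⟨ *-congˡ (+-congʳ (L-u^ k n)) ⟨
    fromℕ (n !) * ((fromℕ (suc n) * b′ + lam * (ν * b)) + b * - (ν * lam))
      ≈⟨ *-congˡ (solve 5 (λ c l ν b m → (c :+ l :* (ν :* b)) :+ b :* m := c :+ b :* (ν :* l :+ m)) refl
           (fromℕ (suc n) * b′) lam ν b (- (ν * lam))) ⟩
    fromℕ (n !) * (fromℕ (suc n) * b′ + b * (ν * lam - ν * lam))
      ≈⟨ *-congˡ (trans (+-congˡ (trans (*-congˡ (-‿inverseʳ _)) (zeroʳ b))) (+-identityʳ _)) ⟩
    fromℕ (n !) * (fromℕ (suc n) * b′)
      ≈⟨ solve 3 (λ a b c → a :* (b :* c) := b :* a :* c) refl (fromℕ (n !)) (fromℕ (suc n)) b′ ⟩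
    fromℕ (suc n) * fromℕ (n !) * b′
      ≈⟨ *-congʳ (fromℕ-* (suc n) (n !)) ⟨
    fromℕ (suc n !) * b′ ∎
    where
    κ ν a b b′ : Carrier
    κ  = fromℕ (suc k)
    ν  = fromℕ n
    a  = (u ^ᵗ k) n
    b  = (u ^ᵗ suc k) n
    b′ = (u ^ᵗ suc k) (suc n)

  -- The term j = N would contain the constant coefficient of a positive power of u, which is 0.
  -- This is why the sum over j ends at N - 1.
  w⋆u^-top : ∀ i N → (w ⋆ u ^ᵗ suc i) N ≈ ∑ N (λ j → w j * (u ^ᵗ suc i) (N ∸ j))
  w⋆u^-top i N = trans (+-congˡ (begin
    w N * (u ^ᵗ suc i) (N ∸ N)  ≈⟨ *-congˡ (reflexive (≡.cong (u ^ᵗ suc i) (ℕₚ.n∸n≡0 N))) ⟩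
    w N * (u ^ᵗ suc i) 0        ≈⟨ *-congˡ (u^-vanishes (suc i) 0 z<s) ⟩
    w N * 0#                    ≈⟨ zeroʳ _ ⟩
    0#                          ∎)) (+-identityʳ _)

  module _ (x : Carrier) where

    ·u^ : ∀ k n → ((x · u) ^ᵗ k) n ≈ x ^ k * (u ^ᵗ k) n
    ·u^ zero    n = sym (*-identityˡ _)
    ·u^ (suc k) n = begin
      ((x · u) ⋆ (x · u) ^ᵗ k) n           ≈⟨ ⋆-cong {f = x · u} (λ _ → refl) (·u^ k) n ⟩
      ((x · u) ⋆ (x ^ k · u ^ᵗ k)) n       ≈⟨ ⋆-·ˡ x u (x ^ k · u ^ᵗ k) n ⟩
      x * (u ⋆ (x ^ k · u ^ᵗ k)) n         ≈⟨ *-congˡ (⋆-comm u (x ^ k · u ^ᵗ k) n) ⟩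
      x * ((x ^ k · u ^ᵗ k) ⋆ u) n         ≈⟨ *-congˡ (⋆-·ˡ (x ^ k) (u ^ᵗ k) u n) ⟩
      x * (x ^ k * (u ^ᵗ k ⋆ u) n)         ≈⟨ *-assoc _ _ _ ⟨
      x ^ suc k * (u ^ᵗ k ⋆ u) n           ≈⟨ *-congˡ (⋆-comm (u ^ᵗ k) u n) ⟩
      x ^ suc k * (u ^ᵗ suc k) n           ∎

    expTerm : ℕ → Carrier
    expTerm k = 1/! k * x ^ k

    -- In positive degree the term k = 0 drops out, which is the -1 in e^{xu} - 1. The remaining m
    -- terms are padded to N, so that one range serves every coefficient up to N.
    exp-·u : ∀ m N → 0 < m → m ≤ N →
             exp (x · u) m ≈ ∑ N (λ i → expTerm (suc i) * (u ^ᵗ suc i) m)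
    -- Matching `m` as a successor lets `one m` reduce to `0#`.
    exp-·u m@(suc _) N _ m≤N = begin
      ∑ (suc m) (λ k → 1/! k * ((x · u) ^ᵗ k) m)
        ≈⟨ ∑-cong (suc m) (λ k _ → trans (*-congˡ (·u^ k m)) (sym (*-assoc _ _ _))) ⟩
      ∑ (suc m) (λ k → expTerm k * (u ^ᵗ k) m)
        ≈⟨ ∑-head m _ ⟩
      expTerm 0 * 0# + ∑ m (λ i → expTerm (suc i) * (u ^ᵗ suc i) m)
        ≈⟨ trans (+-congʳ (zeroʳ _)) (+-identityˡ _) ⟩
      ∑ m (λ i → expTerm (suc i) * (u ^ᵗ suc i) m)
        ≈⟨ ∑-extend _ m≤N (λ i m≤i → trans (*-congˡ (u^-vanishes (suc i) m (s≤s m≤i))) (zeroʳ _)) ⟩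
      ∑ N (λ i → expTerm (suc i) * (u ^ᵗ suc i) m) ∎

    w⋆exp : ∀ N → ∑ N (λ j → w j * exp (x · u) (N ∸ j)) ≈
                  ∑ N (λ i → expTerm (suc i) * (w ⋆ u ^ᵗ suc i) N)
    w⋆exp N = begin
      ∑ N (λ j → w j * exp (x · u) (N ∸ j))
        ≈⟨ ∑-cong N (λ j j<N → *-congˡ (exp-·u (N ∸ j) N (ℕₚ.m<n⇒0<n∸m j<N) (ℕₚ.m∸n≤m N j))) ⟩
      ∑ N (λ j → w j * ∑ N (λ i → expTerm (suc i) * (u ^ᵗ suc i) (N ∸ j)))
        ≈⟨ ∑-cong N (λ j _ → ∑-*ˡ N _ _) ⟩
      ∑ N (λ j → ∑ N (λ i → w j * (expTerm (suc i) * (u ^ᵗ suc i) (N ∸ j))))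
        ≈⟨ ∑-swap N N _ ⟩
      ∑ N (λ i → ∑ N (λ j → w j * (expTerm (suc i) * (u ^ᵗ suc i) (N ∸ j))))
        ≈⟨ ∑-cong N (λ i _ → ∑-cong N λ j _ →
             solve 3 (λ a b c → a :* (b :* c) := b :* (a :* c)) refl (w j) (expTerm (suc i)) ((u ^ᵗ suc i) (N ∸ j))) ⟩
      ∑ N (λ i → ∑ N (λ j → expTerm (suc i) * (w j * (u ^ᵗ suc i) (N ∸ j))))
        ≈⟨ ∑-cong N (λ i _ → trans (sym (∑-*ˡ N _ _)) (*-congˡ (sym (w⋆u^-top i N)))) ⟩
      ∑ N (λ i → expTerm (suc i) * (w ⋆ u ^ᵗ suc i) N) ∎

    -- The given 1/(i+1) cancels the factor i+1 that `θ-u^` produces. The products of a number and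
    -- its inverse are inserted to make `S-egf` and `θ-u^` applicable.
    S-term : ∀ N .{{_ : NonZero N}} i → S N (suc i) * 1/ (suc i) * x ^ suc i ≈
             1/ N * (fromℕ (N !) * (expTerm (suc i) * (w ⋆ u ^ᵗ suc i) N))
    S-term N i = begin
      s * r * y
        ≈⟨ *-congʳ (*-congʳ (trans (*-congˡ (1/!-inverse (suc i))) (*-identityʳ s))) ⟨
      s * (g * f) * r * y
        ≈⟨ solve 5 (λ s g f r y → s :* (g :* f) :* r :* y := s :* f :* (g :* r :* y)) refl s g f r y ⟩
      s * f * (g * r * y)
        ≈⟨ *-congʳ (S-egf N (suc i)) ⟩
      F * v * (g * r * y)
        -- `fromℕ N` is absorbed by `θ-u^`, and `1/ N` survives as the factor 1/n of the theorem.
        ≈⟨ *-congʳ (*-congˡ (trans (*-congʳ (1/-inverse N)) (*-identityˡ v))) ⟨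
      F * (1/ N * fromℕ N * v) * (g * r * y)
        ≈⟨ *-congʳ (*-congˡ (trans (*-assoc _ _ _) (*-congˡ (θ-u^ i N)))) ⟩
      F * (1/ N * (fromℕ (suc i) * W)) * (g * r * y)
        ≈⟨ solve 7 (λ F h k W g r y → F :* (h :* (k :* W)) :* (g :* r :* y) := r :* k :* (h :* (F :* (g :* y :* W)))) refl
             F (1/ N) (fromℕ (suc i)) W g r y ⟩
      r * fromℕ (suc i) * (1/ N * (F * (g * y * W)))
        ≈⟨ trans (*-congʳ (1/-inverse (suc i))) (*-identityˡ _) ⟩
      1/ N * (F * (g * y * W)) ∎
      where
      s r y g f F v W : Carrier
      s = S N (suc i)
      r = 1/ (suc i)
      y = x ^ suc i
      g = 1/! (suc i)
      f = fromℕ (suc i !)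
      F = fromℕ (N !)
      v = (u ^ᵗ suc i) N
      W = (w ⋆ u ^ᵗ suc i) N

    bernoulli-bell-term : ∀ N j → j ≤ N →
      fromℕ (N C j) * bernoulli lam (1# - lam) j * bell lam x (N ∸ j) ≈
      fromℕ (N !) * (w j * exp (x · u) (N ∸ j))
    bernoulli-bell-term N j j≤N = begin
      fromℕ (N C j) * (fromℕ (j !) * w j) * (fromℕ ((N ∸ j) !) * e)
        ≈⟨ solve 5 (λ a b c d e → a :* (b :* c) :* (d :* e) := a :* (b :* d) :* (c :* e)) refl
             (fromℕ (N C j)) (fromℕ (j !)) (w j) (fromℕ ((N ∸ j) !)) e ⟩
      fromℕ (N C j) * (fromℕ (j !) * fromℕ ((N ∸ j) !)) * (w j * e)
        ≈⟨ *-congʳ (trans (fromℕ-* (N C j) _) (*-congˡ (fromℕ-* (j !) ((N ∸ j) !)))) ⟨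
      fromℕ ((N C j) ℕ.* (j ! ℕ.* (N ∸ j) !)) * (w j * e)
        ≈⟨ *-congʳ (reflexive (≡.cong fromℕ (nCk*k!*[n-k]! j≤N))) ⟩
      fromℕ (N !) * (w j * e) ∎
      where
      e : Carrier
      e = exp (x · u) (N ∸ j)

    stirling-sum : ∀ N .{{_ : NonZero N}} →
      ∑ N (λ i → S N (suc i) * 1/ (suc i) * x ^ suc i) ≈
      1/ N * ∑ N (λ j → fromℕ (N C j) * bernoulli lam (1# - lam) j * bell lam x (N ∸ j))
    stirling-sum N = begin
      ∑ N (λ i → S N (suc i) * 1/ (suc i) * x ^ suc i)
        ≈⟨ ∑-cong N (λ i _ → S-term N i) ⟩
      ∑ N (λ i → 1/ N * (fromℕ (N !) * (expTerm (suc i) * (w ⋆ u ^ᵗ suc i) N)))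
        ≈⟨ trans (sym (∑-*ˡ N _ _)) (*-congˡ (sym (∑-*ˡ N _ _))) ⟩
      1/ N * (fromℕ (N !) * ∑ N (λ i → expTerm (suc i) * (w ⋆ u ^ᵗ suc i) N))
        ≈⟨ *-congˡ (*-congˡ (w⋆exp N)) ⟨
      1/ N * (fromℕ (N !) * ∑ N (λ j → w j * exp (x · u) (N ∸ j)))
        ≈⟨ *-congˡ (∑-*ˡ N _ _) ⟩
      1/ N * ∑ N (λ j → fromℕ (N !) * (w j * exp (x · u) (N ∸ j)))
        ≈⟨ *-congˡ (∑-cong N λ j j<N → bernoulli-bell-term N j (ℕₚ.<⇒≤ j<N)) ⟨
      1/ N * ∑ N (λ j → fromℕ (N C j) * bernoulli lam (1# - lam) j * bell lam x (N ∸ j)) ∎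

-- The polynomial ring, its constants and its evaluations.

ringHomomorphism : ∀ {a ℓ₁ b ℓ₂} (A : RawRing a ℓ₁) (B : RawRing b ℓ₂)
  (f : RawRing.Carrier A → RawRing.Carrier B) →
  (∀ {x y} → RawRing._≈_ A x y → RawRing._≈_ B (f x) (f y)) →
  (∀ x y → RawRing._≈_ B (f (RawRing._+_ A x y)) (RawRing._+_ B (f x) (f y))) →
  (∀ x y → RawRing._≈_ B (f (RawRing._*_ A x y)) (RawRing._*_ B (f x) (f y))) →
  (∀ x → RawRing._≈_ B (f (RawRing.-_ A x)) (RawRing.-_ B (f x))) →
  RawRing._≈_ B (f (RawRing.0# A)) (RawRing.0# B) →
  RawRing._≈_ B (f (RawRing.1# A)) (RawRing.1# B) →
  IsRingHomomorphism A B f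
ringHomomorphism A B f cong +-homo *-homo -‿homo 0#-homo 1#-homo = record
  { isSemiringHomomorphism = record
    { isNearSemiringHomomorphism = record
      { +-isMonoidHomomorphism = record
        { isMagmaHomomorphism = record
          { isRelHomomorphism = record { cong = cong }
          ; homo = +-homo
          }
        ; ε-homo = 0#-homo
        }
      ; *-homo = *-homo
      }
    ; 1#-homo = 1#-homo
    }
  ; -‿homo = -‿homo
  }

module PolynomialRing {c ℓ} (R : CommutativeRing c ℓ) where
  open CommutativeRing R hiding (zero) renaming (rawRing to A)
  open Polynomial A hiding (rawRing)
  open RawRing (Polynomial.rawRing A) using () renaming (_≈_ to _≈ˣ_)
  open Sums R
  open FormalSeries R
  open import Algebra.Properties.Ring ring using (-0#≈0#; -‿+-comm; -‿distribʳ-*)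
  open import Algebra.Properties.CommutativeSemigroup +-commutativeSemigroup using (interchange)
  open import Algebra.Solver.Ring.NaturalCoefficients.Default commutativeSemiring using (solve; _:=_; _:+_; _:*_)
  open import Relation.Binary.Reasoning.Setoid setoid

  coeff-add : ∀ p q n → coeff (add p q) n ≈ coeff p n + coeff q n
  coeff-add []      q       n       = sym (+-identityˡ _)
  coeff-add (a ∷ p) []      n       = sym (+-identityʳ _)
  coeff-add (a ∷ p) (b ∷ q) zero    = refl
  coeff-add (a ∷ p) (b ∷ q) (suc n) = coeff-add p q n

  coeff-map : ∀ (f : Carrier → Carrier) → f 0# ≈ 0# → ∀ p n → coeff (map f p) n ≈ f (coeff p n)
  coeff-map f f0≈0 []      n       = sym f0≈0
  coeff-map f f0≈0 (a ∷ p) zero    = refl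
  coeff-map f f0≈0 (a ∷ p) (suc n) = coeff-map f f0≈0 p n

  coeff-mul : ∀ p q n → coeff (mul p q) n ≈ (coeff p ⋆ coeff q) n
  coeff-mul []      q n = sym (∑-zero (suc n) λ i _ → zeroˡ _)
  coeff-mul (a ∷ p) q n = begin
    coeff (add (map (a *_) q) (0# ∷ mul p q)) n
      ≈⟨ coeff-add (map (a *_) q) (0# ∷ mul p q) n ⟩
    coeff (map (a *_) q) n + coeff (0# ∷ mul p q) n
      ≈⟨ +-congʳ (coeff-map (a *_) (zeroʳ a) q n) ⟩
    a * coeff q n + coeff (0# ∷ mul p q) n
      ≈⟨ shift n ⟩
    (coeff (a ∷ p) ⋆ coeff q) n ∎
    where
    shift : ∀ n → a * coeff q n + coeff (0# ∷ mul p q) n ≈ (coeff (a ∷ p) ⋆ coeff q) n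
    shift zero    = +-comm _ _
    shift (suc n) = trans (+-congˡ (coeff-mul p q n)) (sym (⋆-sucˡ (coeff (a ∷ p)) (coeff q) n))

  -- Equality of polynomials is defined through coefficients, so injectivity is immediate and the
  -- ring laws are inherited from power series.
  coeff-isRingMonomorphism : IsRingMonomorphism (Polynomial.rawRing A) (PowerSeries.rawRing A) coeff
  coeff-isRingMonomorphism = record
    { isRingHomomorphism = ringHomomorphism (Polynomial.rawRing A) (PowerSeries.rawRing A) coeff
        (λ p≈q → p≈q) coeff-add coeff-mul (coeff-map -_ -0#≈0#) (λ _ → refl)
        (λ { zero → refl ; (suc _) → refl })
    ; injective = λ p≈q → p≈q
    }

  polynomialRing : CommutativeRing c ℓ
  polynomialRing = record
    { RawRing (Polynomial.rawRing A)
    ; isCommutativeRing = RingMonomorphism.isCommutativeRing coeff-isRingMonomorphism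
        (CommutativeRing.isCommutativeRing seriesRing)
    }

  const-isRingHomomorphism : IsRingHomomorphism A (Polynomial.rawRing A) const
  const-isRingHomomorphism = ringHomomorphism A (Polynomial.rawRing A) const
    (λ { a≈b zero → a≈b ; a≈b (suc _) → refl })
    (λ { a b zero → refl ; a b (suc _) → refl })
    (λ { a b zero → sym (+-identityʳ _) ; a b (suc _) → refl })
    (λ { a zero → refl ; a (suc _) → refl })
    (λ { zero → refl ; (suc _) → refl })
    (λ { zero → refl ; (suc _) → refl })

  module _ (x : Carrier) where

    -- Equal polynomials may be lists of different lengths; this disposes of the surplus zeros in
    -- `eval-cong`.
    eval-zero : ∀ p → (∀ n → coeff p n ≈ 0#) → eval p x ≈ 0#
    eval-zero []      p≈0 = refl
    eval-zero (a ∷ p) p≈0 = begin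
      a + x * eval p x  ≈⟨ +-cong (p≈0 0) (*-congˡ (eval-zero p λ n → p≈0 (suc n))) ⟩
      0# + x * 0#       ≈⟨ trans (+-identityˡ _) (zeroʳ x) ⟩
      0#                ∎

    eval-cong : ∀ p q → p ≈ˣ q → eval p x ≈ eval q x
    eval-cong []      q       p≈q = sym (eval-zero q λ n → sym (p≈q n))
    eval-cong (a ∷ p) []      p≈q = eval-zero (a ∷ p) p≈q
    eval-cong (a ∷ p) (b ∷ q) p≈q = +-cong (p≈q 0) (*-congˡ (eval-cong p q λ n → p≈q (suc n)))

    eval-add : ∀ p q → eval (add p q) x ≈ eval p x + eval q x
    eval-add []      q       = sym (+-identityˡ _)
    eval-add (a ∷ p) []      = sym (+-identityʳ _)
    eval-add (a ∷ p) (b ∷ q) = begin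
      (a + b) + x * eval (add p q) x              ≈⟨ +-congˡ (trans (*-congˡ (eval-add p q)) (distribˡ x _ _)) ⟩
      (a + b) + (x * eval p x + x * eval q x)     ≈⟨ interchange a b _ _ ⟩
      (a + x * eval p x) + (b + x * eval q x)     ∎

    eval-scale : ∀ a p → eval (map (a *_) p) x ≈ a * eval p x
    eval-scale a []      = sym (zeroʳ a)
    eval-scale a (b ∷ p) = begin
      a * b + x * eval (map (a *_) p) x  ≈⟨ +-congˡ (*-congˡ (eval-scale a p)) ⟩
      a * b + x * (a * eval p x)         ≈⟨ solve 4 (λ a b x e → a :* b :+ x :* (a :* e) := a :* (b :+ x :* e)) refl a b x (eval p x) ⟩
      a * (b + x * eval p x)             ∎

    eval-mul : ∀ p q → eval (mul p q) x ≈ eval p x * eval q x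
    eval-mul []      q = sym (zeroˡ _)
    eval-mul (a ∷ p) q = begin
      eval (add (map (a *_) q) (0# ∷ mul p q)) x        ≈⟨ eval-add (map (a *_) q) (0# ∷ mul p q) ⟩
      eval (map (a *_) q) x + (0# + x * eval (mul p q) x) ≈⟨ +-cong (eval-scale a q) (trans (+-identityˡ _) (*-congˡ (eval-mul p q))) ⟩
      a * eval q x + x * (eval p x * eval q x)          ≈⟨ solve 4 (λ a q x p → a :* q :+ x :* (p :* q) := (a :+ x :* p) :* q) refl a (eval q x) x (eval p x) ⟩
      (a + x * eval p x) * eval q x                     ∎

    eval-neg : ∀ p → eval (map -_ p) x ≈ - eval p x
    eval-neg []      = sym -0#≈0#
    eval-neg (a ∷ p) = begin
      - a + x * eval (map -_ p) x  ≈⟨ +-congˡ (*-congˡ (eval-neg p)) ⟩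
      - a + x * - eval p x         ≈⟨ +-congˡ (-‿distribʳ-* x (eval p x)) ⟨
      - a + - (x * eval p x)       ≈⟨ -‿+-comm a _ ⟩
      - (a + x * eval p x)         ∎

    eval-const : ∀ a → eval (const a) x ≈ a
    eval-const a = trans (+-congˡ (zeroʳ x)) (+-identityʳ a)

    eval-X : eval X x ≈ x
    eval-X = trans (+-identityˡ _) (trans (*-congˡ (eval-const 1#)) (*-identityʳ x))

    eval-isRingHomomorphism : IsRingHomomorphism (Polynomial.rawRing A) A (λ p → eval p x)
    eval-isRingHomomorphism = ringHomomorphism (Polynomial.rawRing A) A (λ p → eval p x)
      (λ {p} {q} → eval-cong p q) eval-add eval-mul eval-neg refl (eval-const 1#)

-- Compatibility of the constructions with ring homomorphisms.

module Naturality {c₁ ℓ₁ c₂ ℓ₂} (R₁ : CommutativeRing c₁ ℓ₁) (R₂ : CommutativeRing c₂ ℓ₂)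
  (h : CommutativeRing.Carrier R₁ → CommutativeRing.Carrier R₂)
  (h-hom : IsRingHomomorphism (CommutativeRing.rawRing R₁) (CommutativeRing.rawRing R₂) h) where
  private
    module A = CommutativeRing R₁
    module B = CommutativeRing R₂
    module SA = Sum A.rawRing
    module SB = Sum B.rawRing
    module TA = PowerSeries A.rawRing
    module TB = PowerSeries B.rawRing
    module A⟦t⟧ = RawRing TA.rawRing
    module B⟦t⟧ = RawRing TB.rawRing
  open RawSemiringDefinitions (RawRing.rawSemiring A.rawRing) using () renaming (_^_ to _^₁_)
  open RawSemiringDefinitions (RawRing.rawSemiring B.rawRing) using () renaming (_^_ to _^₂_)
  open IsRingHomomorphism h-hom using (+-homo; *-homo; -‿homo; 0#-homo; 1#-homo)
  open B using (_≈_)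

  infix 4 _↦_ _↦ˢ_

  -- As a relation between two elements, not an equation about `h` of one expression, it lets each
  -- proof follow the clauses of the construction, and in `↦-⊘` it lets the dividends on both sides
  -- change together.
  _↦_ : A.Carrier → B.Carrier → Set ℓ₂
  a ↦ b = h a ≈ b

  _↦ˢ_ : TA.Series → TB.Series → Set ℓ₂
  f ↦ˢ g = ∀ n → f n ↦ g n

  ↦-+ : ∀ {a a′ b b′} → a ↦ b → a′ ↦ b′ → a A.+ a′ ↦ b B.+ b′
  ↦-+ p q = B.trans (+-homo _ _) (B.+-cong p q)

  ↦-* : ∀ {a a′ b b′} → a ↦ b → a′ ↦ b′ → a A.* a′ ↦ b B.* b′
  ↦-* p q = B.trans (*-homo _ _) (B.*-cong p q)

  ↦-neg : ∀ {a b} → a ↦ b → A.- a ↦ B.- b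
  ↦-neg p = B.trans (-‿homo _) (B.-‿cong p)

  ↦-^ : ∀ {a b} k → a ↦ b → a ^₁ k ↦ b ^₂ k
  ↦-^ zero    p = 1#-homo
  ↦-^ (suc k) p = ↦-* p (↦-^ k p)

  ↦-∑ : ∀ n {f g} → f ↦ˢ g → SA.∑ n f ↦ SB.∑ n g
  ↦-∑ zero    p = 0#-homo
  ↦-∑ (suc n) p = ↦-+ (↦-∑ n p) (p n)

  ↦-one : TA.one ↦ˢ TB.one
  ↦-one zero    = 1#-homo
  ↦-one (suc n) = 0#-homo

  ↦-⋆ : ∀ {f f′ g g′} → f ↦ˢ g → f′ ↦ˢ g′ → f A⟦t⟧.* f′ ↦ˢ g B⟦t⟧.* g′
  ↦-⋆ p q n = ↦-∑ (suc n) λ i → ↦-* (p i) (q (n ∸ i))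

  ↦-⊘ : ∀ {f f′ g g′} → f ↦ˢ g → f′ ↦ˢ g′ → f TA.⊘ f′ ↦ˢ g TB.⊘ g′
  ↦-⊘ p q zero    = p 0
  ↦-⊘ p q (suc n) = ↦-⊘ (λ i → ↦-+ (p (suc i)) (↦-neg (↦-* (p 0) (q (suc i))))) q n

  module _ (ι₁ : ℚ → A.Carrier) (ι₂ : ℚ → B.Carrier) (↦-ι : ∀ q → ι₁ q ↦ ι₂ q)
           {lam₁ : A.Carrier} {lam₂ : B.Carrier} (↦-lam : lam₁ ↦ lam₂) where
    private
      module DA = Degenerate A.rawRing ι₁
      module DB = Degenerate B.rawRing ι₂

    ↦-degFalling : ∀ {x y} k → x ↦ y → DA.degFalling lam₁ x k ↦ DB.degFalling lam₂ y k
    ↦-degFalling zero    p = 1#-homo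
    ↦-degFalling (suc k) p = ↦-* (↦-degFalling k p) (↦-+ p (↦-neg (↦-* (↦-ι _) ↦-lam)))

    ↦-degExp : ∀ {x y} → x ↦ y → DA.degExp lam₁ x ↦ˢ DB.degExp lam₂ y
    ↦-degExp p k = ↦-* (↦-degFalling k p) (↦-ι _)

    ↦-bernoulli : ∀ {x y} → x ↦ y → DA.bernoulli lam₁ x ↦ˢ DB.bernoulli lam₂ y
    ↦-bernoulli p n = ↦-* (↦-ι _)
      (↦-⋆ (↦-⊘ ↦-one λ i → ↦-+ (↦-degExp 1#-homo (suc i)) (↦-neg (↦-one (suc i)))) (↦-degExp p) n)

    -- It is the recurrence that is transported: `IsDegStirling₂` quantifies over all elements of
    -- its ring and does not pass directly along `h`.
    ↦-degStirling₂ : ∀ n k → proj₁ (Existence.degStirling₂-exists R₁ ι₁ lam₁) n k ↦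
                             proj₁ (Existence.degStirling₂-exists R₂ ι₂ lam₂) n k
    ↦-degStirling₂ zero    zero    = 1#-homo
    ↦-degStirling₂ zero    (suc k) = 0#-homo
    ↦-degStirling₂ (suc n) zero    = ↦-* (↦-degStirling₂ n 0) (↦-+ (↦-ι _) (↦-neg (↦-* (↦-ι _) ↦-lam)))
    ↦-degStirling₂ (suc n) (suc k) = ↦-+
      (↦-* (↦-degStirling₂ n (suc k)) (↦-+ (↦-ι _) (↦-neg (↦-* (↦-ι _) ↦-lam))))
      (↦-degStirling₂ n k)

-- From the general ring to polynomials and their values.

-- The polynomial ring enters only through its constants η and its evaluations.
module Specialisation {c ℓ c′ ℓ′} (R : CommutativeRing c ℓ) (P : CommutativeRing c′ ℓ′)
  (ι : ℚ → CommutativeRing.Carrier R)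
  (ι-hom : IsRingHomomorphism ℚ.+-*-rawRing (CommutativeRing.rawRing R) ι)
  (η : CommutativeRing.Carrier R → CommutativeRing.Carrier P)
  (η-hom : IsRingHomomorphism (CommutativeRing.rawRing R) (CommutativeRing.rawRing P) η)
  (X : CommutativeRing.Carrier P)
  (ev : CommutativeRing.Carrier P → CommutativeRing.Carrier R → CommutativeRing.Carrier R)
  (ev-hom : ∀ a → IsRingHomomorphism (CommutativeRing.rawRing P) (CommutativeRing.rawRing R) (λ p → ev p a))
  (ev-η : ∀ a b → CommutativeRing._≈_ R (ev (η b) a) b)
  (ev-X : ∀ a → CommutativeRing._≈_ R (ev X a) a) where
  private
    module R = CommutativeRing R
    module P = CommutativeRing P
    module DR = Degenerate R.rawRing ι
    module DP = Degenerate P.rawRing (λ q → η (ι q))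
    module NP = Naturality R P η η-hom
    module SP = Sums P
  open R using (_≈_)
  open RawSemiringDefinitions (RawRing.rawSemiring P.rawRing) using (_^_)
  open RawSemiringDefinitions (RawRing.rawSemiring R.rawRing) using () renaming (_^_ to _^ᴿ_)
  open IsRingHomomorphism η-hom using (⟦⟧-cong; *-homo; 1#-homo)

  ηι-hom : IsRingHomomorphism ℚ.+-*-rawRing P.rawRing (λ q → η (ι q))
  ηι-hom = isRingHomomorphism P.trans ι-hom η-hom

  module _ (lam : R.Carrier) (S₂ : ℕ → ℕ → R.Carrier) (S₂-isStirling : DR.IsDegStirling₂ lam S₂)
           (n : ℕ) .{{_ : NonZero n}} where

    β : ℕ → R.Carrier
    β j = ev (DP.bernoulli (η lam) X j) (R.1# R.- lam)

    -- Two homomorphisms in succession: evaluation at 1-λ sends β_j(X) to the Bernoulli value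
    -- computed in `R`, and `η` sends that to the value computed in `P`, the one occurring in
    -- `stirling-sum`.
    ηβ : ∀ j → η (β j) P.≈ DP.bernoulli (η lam) (P.1# P.- η lam) j
    ηβ j = P.trans
      (⟦⟧-cong (Naturality.↦-bernoulli P R (λ p → ev p (R.1# R.- lam)) (ev-hom _)
        (λ q → η (ι q)) ι (λ q → ev-η _ _) (ev-η _ _) (ev-X _) j))
      (NP.↦-bernoulli ι (λ q → η (ι q)) (λ q → P.refl) P.refl
        (NP.↦-+ 1#-homo (NP.↦-neg P.refl)) j)

    -- Uniqueness over `R` identifies `S₂` with the recursive solution, which is then carried to
    -- `P`. The bound k ≤ n is the range in which `IsDegStirling₂` determines `S₂ n k`.
    ηS₂ : ∀ k → k ≤ n → η (S₂ n k) P.≈ proj₁ (Existence.degStirling₂-exists P (λ q → η (ι q)) (η lam)) n k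
    ηS₂ k k≤n = P.trans
      (⟦⟧-cong (StirlingUniqueness.degStirling₂-unique R ι ι-hom lam S₂ _ S₂-isStirling
        (proj₂ (Existence.degStirling₂-exists R ι lam)) n k k≤n))
      (NP.↦-degStirling₂ ι (λ q → η (ι q)) (λ q → P.refl) P.refl n k)

    polynomial-identity :
      SP.∑ n (λ i → η (S₂ n (suc i) R.* DR.1/ (suc i)) P.* X ^ suc i) P.≈
      η (DR.1/ n) P.* SP.∑ n (λ j → η (DR.fromℕ (n C j) R.* β j) P.* DP.bell (η lam) X (n ∸ j))
    polynomial-identity = P.trans
      (SP.∑-cong n λ i i<n → P.*-congʳ (P.trans (*-homo _ _) (P.*-congʳ (ηS₂ (suc i) i<n))))
      (P.trans (DegenerateSeries.stirling-sum P (λ q → η (ι q)) ηι-hom (η lam) X n)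
        (P.*-congˡ (SP.∑-cong n λ j _ → P.*-congʳ
          (P.trans (P.*-congˡ (P.sym (ηβ j))) (P.sym (*-homo _ _))))))

    -- Evaluation at 1 is a homomorphism that undoes `η` and sends every power of X to 1, so it
    -- turns the polynomial identity into this one.
    value-identity :
      Sum.∑ R.rawRing n (λ i → S₂ n (suc i) R.* DR.1/ (suc i)) ≈
      DR.1/ n R.* Sum.∑ R.rawRing n (λ j → DR.fromℕ (n C j) R.* β j R.* ev (DP.bell (η lam) X (n ∸ j)) R.1#)
    value-identity = begin
      Sum.∑ R.rawRing n (λ i → S₂ n (suc i) R.* DR.1/ (suc i))
        ≈⟨ E.↦-∑ n (λ i → R.trans (E.↦-* (ev-η _ _) (R.trans (E.↦-^ (suc i) (ev-X _)) (1^ (suc i)))) (R.*-identityʳ _)) ⟨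
      ev (SP.∑ n (λ i → η (S₂ n (suc i) R.* DR.1/ (suc i)) P.* X ^ suc i)) R.1#
        ≈⟨ IsRingHomomorphism.⟦⟧-cong (ev-hom R.1#) polynomial-identity ⟩
      ev (η (DR.1/ n) P.* SP.∑ n (λ j → η (DR.fromℕ (n C j) R.* β j) P.* DP.bell (η lam) X (n ∸ j))) R.1#
        ≈⟨ E.↦-* (ev-η _ _) (E.↦-∑ n λ j → E.↦-* (ev-η _ _) R.refl) ⟩
      DR.1/ n R.* Sum.∑ R.rawRing n (λ j → DR.fromℕ (n C j) R.* β j R.* ev (DP.bell (η lam) X (n ∸ j)) R.1#) ∎
      where
      open import Relation.Binary.Reasoning.Setoid R.setoid
      module E = Naturality P R (λ p → ev p R.1#) (ev-hom R.1#)
      1^ : ∀ k → R.1# ^ᴿ k ≈ R.1#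
      1^ zero    = R.refl
      1^ (suc k) = R.trans (R.*-identityˡ _) (1^ k)

-- A record with every operation a parameter: two instances are compared one
-- operation at a time, without computing with concrete reals.
record StirlingBellIdentity {c ℓ} {V W : Set c}
  (_≈_ : V → V → Set ℓ) (_*_ : V → V → V) (∑ : ℕ → (ℕ → V) → V)
  (_≈ˣ_ : W → W → Set ℓ) (_*ˣ_ : W → W → W) (∑ˣ : ℕ → (ℕ → W) → W)
  (fromℕ : ℕ → V) (1/_ : (n : ℕ) → .{{NonZero n}} → V)
  (const : V → W) (X^_ : ℕ → W) (eval : W → V → V)
  (x : V) (β φ : ℕ → W) (φ₁ : ℕ → V) (S₂ : ℕ → ℕ → V) (n : ℕ) .{{_ : NonZero n}} : Set ℓ where
  field
    polynomial-identity :
      ∑ˣ n (λ i → const (S₂ n (suc i) * (1/ (suc i))) *ˣ (X^ (suc i))) ≈ˣ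
      (const (1/ n) *ˣ ∑ˣ n (λ j → const (fromℕ (n C j) * eval (β j) x) *ˣ φ (n ∸ j)))
    value-identity :
      ∑ n (λ i → S₂ n (suc i) * (1/ (suc i))) ≈
      ((1/ n) * ∑ n (λ j → (fromℕ (n C j) * eval (β j) x) * φ₁ (n ∸ j)))

module PolynomialTheorem {c ℓ} (R : CommutativeRing c ℓ)
  (ι : ℚ → CommutativeRing.Carrier R)
  (ι-hom : IsRingHomomorphism ℚ.+-*-rawRing (CommutativeRing.rawRing R) ι) where
  open CommutativeRing R renaming (rawRing to A)
  open Degenerate A ι using (∑; fromℕ; 1/_; IsDegStirling₂)
  open Polynomial A using (const; X; eval)
  open RawRing (Polynomial.rawRing A) using () renaming (_≈_ to _≈ˣ_; _*_ to _*ˣ_)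
  open RawSemiringDefinitions (RawRing.rawSemiring (Polynomial.rawRing A)) using () renaming (_^_ to _^ˣ_)
  open Degenerate (Polynomial.rawRing A) (λ q → const (ι q)) using (bernoulli; bell) renaming (∑ to ∑ˣ)
  open PolynomialRing R
  open Specialisation R polynomialRing ι ι-hom
    const const-isRingHomomorphism X eval eval-isRingHomomorphism eval-const eval-X

  stirling-bell-identity : (lam : Carrier) (S₂ : ℕ → ℕ → Carrier) → IsDegStirling₂ lam S₂ →
    (n : ℕ) → .{{_ : NonZero n}} →
    StirlingBellIdentity _≈_ _*_ ∑ _≈ˣ_ _*ˣ_ ∑ˣ fromℕ 1/_ const (X ^ˣ_) eval
      (1# - lam) (bernoulli (const lam) X) (bell (const lam) X) (λ m → eval (bell (const lam) X m) 1#) S₂ n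
  stirling-bell-identity lam S₂ S₂-isStirling n = record
    { polynomial-identity = polynomial-identity lam S₂ S₂-isStirling n
    ; value-identity      = value-identity lam S₂ S₂-isStirling n
    }

-- Specialisation to the real numbers.

open import Defs

-- The real operations act termwise, so both sides of each law are the same constant sequence.
-- `_≈ℝ_` looks only at sequences, hence reflexivity suffices although the Cauchy proofs differ.
fromℚ-isRingHomomorphism : IsRingHomomorphism ℚ.+-*-rawRing ℝ-rawRing fromℚ
fromℚ-isRingHomomorphism = ringHomomorphism ℚ.+-*-rawRing ℝ-rawRing fromℚ
  (λ { {x} ≡.refl → refl {fromℚ x} })
  (λ p q ε 0<ε → refl {fromℚ (p ℚ.+ q)} ε 0<ε)
  (λ p q ε 0<ε → refl {fromℚ (p ℚ.* q)} ε 0<ε)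
  (λ p ε 0<ε → refl {fromℚ (ℚ.- p)} ε 0<ε)
  (refl {0ℝ})
  (refl {1ℝ})
  where open CommutativeRing ℝ-commutativeRing using (refl)

theorem12 : (lam : ℝ) → ¬ (lam ≈ℝ 0ℝ) →
    (S₂ : ℕ → ℕ → ℝ) → IsDegStirling₂ lam S₂ →
    (n : ℕ) → .{{_ : NonZero n}} →
    (∑ˣ n (λ i → const (S₂ n (suc i) *ℝ 1/ (suc i)) *ˣ X ^ˣ suc i)
    ≈ˣ const (1/ n) *ˣ ∑ˣ n (λ j → const (fromℕ (n C j) *ℝ eval (degBernoulli lam j) (1ℝ +ℝ -ℝ lam)) *ˣ degBell lam (n ∸ j)))
    ×
    (∑ n (λ i → S₂ n (suc i) *ℝ 1/ (suc i))
    ≈ℝ 1/ n *ℝ ∑ n (λ j → fromℕ (n C j) *ℝ eval (degBernoulli lam j) (1ℝ +ℝ -ℝ lam) *ℝ degBellNumber lam (n ∸ j)))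
theorem12 lam _ S₂ S₂-isStirling n = polynomial-identity , value-identity
  where
  identity : StirlingBellIdentity _≈ℝ_ _*ℝ_ ∑ _≈ˣ_ _*ˣ_ ∑ˣ fromℕ 1/_ const (X ^ˣ_) eval
    (1ℝ +ℝ -ℝ lam) (degBernoulli lam) (degBell lam) (degBellNumber lam) S₂ n
  identity = PolynomialTheorem.stirling-bell-identity
    ℝ-commutativeRing fromℚ fromℚ-isRingHomomorphism lam S₂ S₂-isStirling n
  open StirlingBellIdentity identity
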